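{- Let $\epsilon\in(0,1]$ be fixed. The energy complexity of computing a $(2-\epsilon)$-approximation of the diameter is $\Omega(n)$, even on the class of unit-disc graphs. That is, every randomized algorithm that, on every $n$-vertex unit-disc graph $G$, with high probability computes a $(2-\epsilon)$-approximation of $\mathrm{diam}(G)$ has energy cost $\Omega(n)$. This holds in the model $\mathsf{RN}[\infty]$ (messages of unbounded size), and also when the network supports collision detection.
   Context: Radio Network model $\mathsf{RN}[b]$: devices are placed at the vertices of an unknown undirected graph $G=(V,E)$. Time is partitioned into synchronous discrete steps, all devices agree on time zero and on an upper bound $n\ge|V|$. In each step each device performs arbitrary local computation and chooses to idle, listen, or transmit a message of at most $b$ bits ($b=\infty$ means no size constraint). If $v$ listens and exactly one neighbor $u\in N(v)$ transmits, then $v$ receives $u$'s message; otherwise $v$ receives no feedback. With collision detection, a listener $v$ can additionally distinguish the case that no vertex of $N(v)$ transmits (silence) from the case that at least two vertices of $N(v)$ transmit (noise). Devices can generate independent unbiased local random bits. The energy cost of a vertex is the number of steps in which it listens or transmits; the energy cost of an algorithm is the maximum energy cost over all devices. All devices halt and return an output. For $c\ge 1$, a $c$-approximation of the diameter is a value $D'$ with $\mathrm{diam}(G)/c\le D'\le \mathrm{diam}(G)$. A unit-disc graph is the intersection graph of unit discs in the plane. "With high probability" means with probability $1-1/\mathrm{poly}(n)$. -}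

module Defs where

import Data.Rational.Properties as ℚ
open import Algebra.Bundles using (CommutativeMonoid)
open import Algebra.Properties.CommutativeSemigroup
  (CommutativeMonoid.commutativeSemigroup ℚ.+-0-commutativeMonoid)
  using (interchange)
open import Data.Bool using (Bool; true; false; if_then_else_)
open import Data.Fin using (Fin; toℕ)
open import Data.Integer using (+_)
open import Data.List using (List; []; _∷_; allFin; length; mapMaybe)
open import Data.List.Relation.Unary.All using (All)
open import Data.List.Relation.Unary.Unique.Propositional using (Unique)
open import Data.Maybe using (Maybe; just; nothing)
open import Data.Nat as ℕ using (ℕ; zero; suc; NonZero)
import Data.Nat.Properties as ℕ
open import Data.Product using (Σ-syntax; ∃-syntax; _×_; _,_)
open import Data.Rational as ℚ using (ℚ; 0ℚ; 1ℚ; ∣_∣; 1/_)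
open import Data.Vec using (Vec; lookup; tabulate)
open import Function.Bundles using (_⇔_)
open import Relation.Binary.PropositionalEquality
  using (_≡_; _≢_; sym; trans; cong; cong₂; subst)

Cauchy : (ℕ → ℚ) → Set
Cauchy x = ∀ ε → 0ℚ ℚ.< ε →
  ∃[ N ] (∀ i j → N ℕ.≤ i → N ℕ.≤ j → ∣ x i ℚ.- x j ∣ ℚ.≤ ε)

record ℝ : Set where
  constructor real
  field
    approx : ℕ → ℚ
    cauchy : Cauchy approx

open ℝ public

infix 4 _≤ℝ_ _<ℝ_

_≤ℝ_ : ℝ → ℝ → Set
x ≤ℝ y = ∀ ε → 0ℚ ℚ.< ε →
  ∃[ N ] (∀ i → N ℕ.≤ i → approx x i ℚ.≤ approx y i ℚ.+ ε)

_<ℝ_ : ℝ → ℝ → Set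
x <ℝ y = ∃[ δ ] (0ℚ ℚ.< δ ×
  ∃[ N ] (∀ i → N ℕ.≤ i → approx x i ℚ.+ δ ℚ.≤ approx y i))

private
  halve : ∀ ε → 0ℚ ℚ.< ε → ∃[ δ ] (0ℚ ℚ.< δ × δ ℚ.+ δ ≡ ε)
  halve ε 0<ε =
    ε ℚ.* ℚ.½ ,
    ℚ.positive⁻¹ _ {{ℚ.pos*pos⇒pos ε {{ℚ.positive 0<ε}} ℚ.½}} ,
    trans (sym (ℚ.*-distribˡ-+ ε ℚ.½ ℚ.½)) (ℚ.*-identityʳ ε)

  0<+ : ∀ {p q} → 0ℚ ℚ.< p → 0ℚ ℚ.< q → 0ℚ ℚ.< p ℚ.+ q
  0<+ 0<p 0<q = ℚ.+-mono-< 0<p 0<q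

  +-cauchy : ∀ {x y} → Cauchy x → Cauchy y → Cauchy (λ i → x i ℚ.+ y i)
  +-cauchy {x} {y} cx cy ε 0<ε with halve ε 0<ε
  ... | δ , 0<δ , δ+δ≡ε with cx δ 0<δ | cy δ 0<δ
  ... | M , hx | N , hy = M ℕ.⊔ N , λ i j p q → begin
    ∣ (x i ℚ.+ y i) ℚ.- (x j ℚ.+ y j) ∣
      ≡⟨ cong ∣_∣ (rearrange (x i) (y i) (x j) (y j)) ⟩
    ∣ (x i ℚ.- x j) ℚ.+ (y i ℚ.- y j) ∣
      ≤⟨ ℚ.∣p+q∣≤∣p∣+∣q∣ (x i ℚ.- x j) (y i ℚ.- y j) ⟩
    ∣ x i ℚ.- x j ∣ ℚ.+ ∣ y i ℚ.- y j ∣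
      ≤⟨ ℚ.+-mono-≤
           (hx i j (ℕ.m⊔n≤o⇒m≤o M N p) (ℕ.m⊔n≤o⇒m≤o M N q))
           (hy i j (ℕ.m⊔n≤o⇒n≤o M N p) (ℕ.m⊔n≤o⇒n≤o M N q)) ⟩
    δ ℚ.+ δ ≡⟨ δ+δ≡ε ⟩
    ε ∎
    where
    open ℚ.≤-Reasoning
    rearrange : ∀ a b c d →
      (a ℚ.+ b) ℚ.- (c ℚ.+ d) ≡ (a ℚ.- c) ℚ.+ (b ℚ.- d)
    rearrange a b c d =
      trans (cong (a ℚ.+ b ℚ.+_) (ℚ.neg-distrib-+ c d))
        (interchange a b (ℚ.- c) (ℚ.- d))

  neg-cauchy : ∀ {x} → Cauchy x → Cauchy (λ i → ℚ.- x i)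
  neg-cauchy {x} cx ε 0<ε with cx ε 0<ε
  ... | N , hx = N , λ i j p q →
    subst (ℚ._≤ ε)
      (trans (sym (ℚ.∣-p∣≡∣p∣ (x i ℚ.- x j)))
        (cong ∣_∣ (ℚ.neg-distrib-+ (x i) (ℚ.- x j))))
      (hx i j p q)

  bounded : ∀ {x} → Cauchy x →
    ∃[ B ] (0ℚ ℚ.< B × ∃[ N ] (∀ i → N ℕ.≤ i → ∣ x i ∣ ℚ.≤ B))
  bounded {x} cx with cx 1ℚ (ℚ.positive⁻¹ 1ℚ)
  ... | N , hx =
    ∣ x N ∣ ℚ.+ 1ℚ ,
    ℚ.+-mono-≤-< (ℚ.0≤∣p∣ (x N)) (ℚ.positive⁻¹ 1ℚ) ,
    N , λ i p → begin
      ∣ x i ∣                        ≡⟨ cong ∣_∣ (split (x i) (x N)) ⟩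
      ∣ x N ℚ.+ (x i ℚ.- x N) ∣      ≤⟨ ℚ.∣p+q∣≤∣p∣+∣q∣ (x N) (x i ℚ.- x N) ⟩
      ∣ x N ∣ ℚ.+ ∣ x i ℚ.- x N ∣    ≤⟨ ℚ.+-monoʳ-≤ ∣ x N ∣ (hx i N p ℕ.≤-refl) ⟩
      ∣ x N ∣ ℚ.+ 1ℚ                 ∎
    where
    open ℚ.≤-Reasoning
    split : ∀ a b → a ≡ b ℚ.+ (a ℚ.- b)
    split a b = sym (trans (ℚ.+-comm b (a ℚ.- b)) (trans (ℚ.+-assoc a (ℚ.- b) b)
      (trans (cong (a ℚ.+_) (ℚ.+-inverseˡ b)) (ℚ.+-identityʳ a))))

  *-mono-∣∣ : ∀ p q {a b} → ∣ p ∣ ℚ.≤ a → ∣ q ∣ ℚ.≤ b → ∣ p ℚ.* q ∣ ℚ.≤ a ℚ.* b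
  *-mono-∣∣ p q {a} {b} p≤a q≤b = begin
    ∣ p ℚ.* q ∣          ≡⟨ ℚ.∣p*q∣≡∣p∣*∣q∣ p q ⟩
    ∣ p ∣ ℚ.* ∣ q ∣      ≤⟨ ℚ.*-monoʳ-≤-nonNeg ∣ q ∣ {{ℚ.nonNegative (ℚ.0≤∣p∣ q)}} p≤a ⟩
    a ℚ.* ∣ q ∣          ≤⟨ ℚ.*-monoˡ-≤-nonNeg a
                             {{ℚ.nonNegative (ℚ.≤-trans (ℚ.0≤∣p∣ p) p≤a)}} q≤b ⟩
    a ℚ.* b              ∎
    where open ℚ.≤-Reasoning

  scale : ∀ ε B → 0ℚ ℚ.< ε → 0ℚ ℚ.< B → ∃[ δ ] (0ℚ ℚ.< δ × B ℚ.* δ ≡ ε)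
  scale ε B 0<ε 0<B =
    B⁻¹ ℚ.* ε ,
    ℚ.positive⁻¹ _ {{ℚ.pos*pos⇒pos B⁻¹ {{ℚ.1/pos⇒pos B}} ε {{ℚ.positive 0<ε}}}} ,
    trans (sym (ℚ.*-assoc B B⁻¹ ε))
      (trans (cong (ℚ._* ε) (ℚ.*-inverseʳ B)) (ℚ.*-identityˡ ε))
    where
    instance
      B>0 : ℚ.Positive B
      B>0 = ℚ.positive 0<B
      B≢0 : ℚ.NonZero B
      B≢0 = ℚ.pos⇒nonZero B
    B⁻¹ : ℚ
    B⁻¹ = 1/ B

  *-cauchy : ∀ {x y} → Cauchy x → Cauchy y → Cauchy (λ i → x i ℚ.* y i)
  *-cauchy {x} {y} cx cy ε 0<ε with bounded cx | bounded cy
  ... | A , 0<A , K , hA | B , 0<B , L , hB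
    with scale ε (A ℚ.+ B) 0<ε (0<+ 0<A 0<B)
  ... | δ , 0<δ , eq with cx δ 0<δ | cy δ 0<δ
  ... | M , hx | N , hy = (K ℕ.⊔ L) ℕ.⊔ (M ℕ.⊔ N) , λ i j p q →
    let p₁ = ℕ.m⊔n≤o⇒m≤o (K ℕ.⊔ L) (M ℕ.⊔ N) p
        p₂ = ℕ.m⊔n≤o⇒n≤o (K ℕ.⊔ L) (M ℕ.⊔ N) p
        q₁ = ℕ.m⊔n≤o⇒m≤o (K ℕ.⊔ L) (M ℕ.⊔ N) q
        q₂ = ℕ.m⊔n≤o⇒n≤o (K ℕ.⊔ L) (M ℕ.⊔ N) q
    in begin
    ∣ x i ℚ.* y i ℚ.- x j ℚ.* y j ∣
      ≡⟨ cong ∣_∣ (rearrange (x i) (y i) (x j) (y j)) ⟩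
    ∣ x i ℚ.* (y i ℚ.- y j) ℚ.+ y j ℚ.* (x i ℚ.- x j) ∣
      ≤⟨ ℚ.∣p+q∣≤∣p∣+∣q∣ (x i ℚ.* (y i ℚ.- y j)) (y j ℚ.* (x i ℚ.- x j)) ⟩
    ∣ x i ℚ.* (y i ℚ.- y j) ∣ ℚ.+ ∣ y j ℚ.* (x i ℚ.- x j) ∣
      ≤⟨ ℚ.+-mono-≤
           (*-mono-∣∣ (x i) (y i ℚ.- y j) (hA i (ℕ.m⊔n≤o⇒m≤o K L p₁))
             (hy i j (ℕ.m⊔n≤o⇒n≤o M N p₂) (ℕ.m⊔n≤o⇒n≤o M N q₂)))
           (*-mono-∣∣ (y j) (x i ℚ.- x j) (hB j (ℕ.m⊔n≤o⇒n≤o K L q₁))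
             (hx i j (ℕ.m⊔n≤o⇒m≤o M N p₂) (ℕ.m⊔n≤o⇒m≤o M N q₂))) ⟩
    A ℚ.* δ ℚ.+ B ℚ.* δ  ≡⟨ sym (ℚ.*-distribʳ-+ δ A B) ⟩
    (A ℚ.+ B) ℚ.* δ      ≡⟨ eq ⟩
    ε ∎
    where
    open ℚ.≤-Reasoning
    telescope : ∀ a b c → (a ℚ.- b) ℚ.+ (b ℚ.- c) ≡ a ℚ.- c
    telescope a b c = trans (ℚ.+-assoc a (ℚ.- b) (b ℚ.- c))
      (cong (a ℚ.+_) (trans (sym (ℚ.+-assoc (ℚ.- b) b (ℚ.- c)))
        (trans (cong (ℚ._- c) (ℚ.+-inverseˡ b)) (ℚ.+-identityˡ (ℚ.- c)))))
    factor : ∀ a b d → a ℚ.* (b ℚ.- d) ≡ a ℚ.* b ℚ.- a ℚ.* d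
    factor a b d = trans (ℚ.*-distribˡ-+ a b (ℚ.- d))
      (cong (a ℚ.* b ℚ.+_) (sym (ℚ.neg-distribʳ-* a d)))
    rearrange : ∀ a b c d →
      a ℚ.* b ℚ.- c ℚ.* d ≡ a ℚ.* (b ℚ.- d) ℚ.+ d ℚ.* (a ℚ.- c)
    rearrange a b c d = sym (trans
      (cong₂ ℚ._+_ (factor a b d)
        (trans (factor d a c) (cong₂ ℚ._-_ (ℚ.*-comm d a) (ℚ.*-comm d c))))
      (telescope (a ℚ.* b) (a ℚ.* d) (c ℚ.* d)))

fromℚ : ℚ → ℝ
fromℚ p = real (λ _ → p) λ ε 0<ε → 0 , λ _ _ _ _ →
  subst (ℚ._≤ ε) (sym (cong ∣_∣ (ℚ.+-inverseʳ p))) (ℚ.<⇒≤ 0<ε)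

fromℕ : ℕ → ℝ
fromℕ n = fromℚ ((+ n) ℚ./ 1)

infixl 6 _+ℝ_ _-ℝ_
infixl 7 _*ℝ_

_+ℝ_ : ℝ → ℝ → ℝ
real x cx +ℝ real y cy = real (λ i → x i ℚ.+ y i) (+-cauchy {x} {y} cx cy)

-ℝ_ : ℝ → ℝ
-ℝ real x cx = real (λ i → ℚ.- x i) (neg-cauchy {x} cx)

_-ℝ_ : ℝ → ℝ → ℝ
x -ℝ y = x +ℝ (-ℝ y)

_*ℝ_ : ℝ → ℝ → ℝ
real x cx *ℝ real y cy = real (λ i → x i ℚ.* y i) (*-cauchy {x} {y} cx cy)

record Graph (n : ℕ) : Set where
  field
    adj       : Fin n → Fin n → Bool
    symmetric : ∀ u v → adj u v ≡ adj v u
    loopless  : ∀ v → adj v v ≡ false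

open Graph public

module _ {n : ℕ} (G : Graph n) where

  data Walk : Fin n → Fin n → ℕ → Set where
    stop : ∀ {v} → Walk v v 0
    step : ∀ {u v w k} → adj G u v ≡ true → Walk v w k → Walk u w (suc k)

  Connected : Set
  Connected = ∀ u v → ∃[ k ] Walk u v k

  Distance : Fin n → Fin n → ℕ → Set
  Distance u v d = Walk u v d × (∀ k → Walk u v k → d ℕ.≤ k)

  IsDiameter : ℕ → Set
  IsDiameter D =
    (∀ u v → ∃[ d ] (d ℕ.≤ D × Distance u v d)) ×
    (∃[ u ] ∃[ v ] Distance u v D)

  -- The condition diam / c ≤ x is written diam ≤ c · x, avoiding division.
  IsDiameterApprox : ℝ → ℝ → Set
  IsDiameterApprox c x =
    ∃[ D ] (IsDiameter D × fromℕ D ≤ℝ c *ℝ x × x ≤ℝ fromℕ D)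

record Point : Set where
  constructor point
  field
    xCoord yCoord : ℝ

open Point public

-- The first argument is the centre of the closed disc.
InUnitDisc : Point → Point → Set
InUnitDisc c p = dx *ℝ dx +ℝ dy *ℝ dy ≤ℝ fromℕ 1
  where
  dx dy : ℝ
  dx = xCoord p -ℝ xCoord c
  dy = yCoord p -ℝ yCoord c

IsUnitDisc : ∀ {n} → Graph n → Set
IsUnitDisc {n} G = Σ[ centre ∈ (Fin n → Point) ] (∀ u v →
  adj G u v ≡ true ⇔
  (u ≢ v × ∃[ p ] (InUnitDisc (centre u) p × InUnitDisc (centre v) p)))

-- Messages are bit strings of unrestricted length (b = ∞).
Message : Set
Message = List Bool

data Model : Set where
  RN RN-CD : Model

data Feedback : Set where
  silence noise : Feedback
  message       : Message → Feedback

-- The list holds the messages sent by the listener's neighbours.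
-- Without collision detection a collision looks exactly like silence.
perceive : Model → List Message → Feedback
perceive _     []          = silence
perceive _     (m ∷ [])    = message m
perceive RN    (_ ∷ _ ∷ _) = silence
perceive RN-CD (_ ∷ _ ∷ _) = noise

data Move (S : Set) : Set where
  halt     : ℝ → Move S
  idle     : S → Move S
  listen   : (Feedback → S) → Move S
  transmit : Message → S → Move S

-- All devices run the same program.  In each step a device in state s draws
-- `coins s` fresh random bits and then chooses its move.
record Protocol : Set₁ where
  field
    State : Set
    start : State
    coins : State → ℕ
    move  : (s : State) → Vec Bool (coins s) → Move State

open Protocol public

-- The argument is the bound n on the number of vertices known to all devices.
Algorithm : Set₁
Algorithm = ℕ → Protocol

Coins : ℕ → Set
Coins n = Fin n → ℕ → Bool

-- The tape of a running device holds its unused random bits; the last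
-- component of either constructor is the energy spent so far.
data Device (S : Set) : Set where
  running : S → (tape : ℕ → Bool) → ℕ → Device S
  halted  : ℝ → ℕ → Device S

output : ∀ {S} → Device S → Maybe ℝ
output (running _ _ _) = nothing
output (halted x _)    = just x

energy : ∀ {S} → Device S → ℕ
energy (running _ _ e) = e
energy (halted _ e)    = e

module _ (P : Protocol) where

  chosenMove : State P → (ℕ → Bool) → Move (State P)
  chosenMove s tape = move P s (tabulate (λ i → tape (toℕ i)))

  sent : Device (State P) → Maybe Message
  sent (halted _ _) = nothing
  sent (running s tape _) with chosenMove s tape
  ... | transmit m _ = just m
  ... | _            = nothing

  advance : Feedback → Device (State P) → Device (State P)
  advance _ (halted x e) = halted x e
  advance f (running s tape e) with chosenMove s tape
  ... | halt x       = halted x e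
  ... | idle s′      = running s′ (λ i → tape (coins P s ℕ.+ i)) e
  ... | listen k     = running (k f) (λ i → tape (coins P s ℕ.+ i)) (suc e)
  ... | transmit _ s′ = running s′ (λ i → tape (coins P s ℕ.+ i)) (suc e)

  module _ (μ : Model) {n : ℕ} (G : Graph n) where

    heard : (Fin n → Device (State P)) → Fin n → List Message
    heard devices v =
      mapMaybe (λ u → if adj G v u then sent (devices u) else nothing) (allFin n)

    run : Coins n → ℕ → Fin n → Device (State P)
    run ω zero    v = running (start P) (ω v) 0
    run ω (suc t) v = advance (perceive μ (heard (run ω t) v)) (run ω t v)

_Extends_ : ∀ {n m} → Coins n → Vec (Vec Bool m) n → Set
_Extends_ {n} {m} ω w = ∀ v (i : Fin m) → ω v (toℕ i) ≡ lookup (lookup w v) i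

-- Under independent fair coins, the event E has probability at least p: for
-- every q < p, E contains finitely many disjoint cylinders of total measure at
-- least q.  This agrees with Lebesgue measure on open events, i.e. those
-- whose occurrence is witnessed by finitely many bits.
ProbAtLeast : ∀ {n} → (Coins n → Set) → ℚ → Set
ProbAtLeast {n} E p = ∀ q → q ℚ.< p →
  ∃[ m ] Σ[ S ∈ List (Vec (Vec Bool m) n) ]
    Unique S ×
    All (λ w → ∀ ω → ω Extends w → E ω) S ×
    q ℚ.* ((+ (2 ℕ.^ (n ℕ.* m))) ℚ./ 1) ℚ.≤ (+ length S) ℚ./ 1

-- The devices need not agree on their outputs, and halting is required only
-- within this event.
Succeeds : Model → ℝ → Protocol → ∀ {n} → Graph n → Coins n → Set
Succeeds μ c P G ω = ∃[ t ] (∀ v →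
  ∃[ x ] (output (run P μ G ω t v) ≡ just x × IsDiameterApprox G c x))

-- The success probability is at least 1 - 1/poly(n), written 1 - C/nᵏ with
-- k ≥ 1.
ApproximatesDiameterWHP : Model → ℝ → Algorithm → Set
ApproximatesDiameterWHP μ c A = ∃[ C ] ∃[ k ] (1 ℕ.≤ k ×
  (∀ n .{{_ : NonZero n}} (G : Graph n) → Connected G → IsUnitDisc G →
    ProbAtLeast (Succeeds μ c (A n) G)
      (1ℚ ℚ.- (ℚ._/_ (+ C) (n ℕ.^ k) {{ℕ.m^n≢0 n k}}))))

-- Energy cost is a worst case over the random bits as well as the devices.
EnergyCostAtMost : Model → Algorithm → ℕ → ℕ → Set
EnergyCostAtMost μ A n E =
  ∀ (G : Graph n) → Connected G → IsUnitDisc G →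
  ∀ ω t v → energy (run (A n) μ G ω t v) ℕ.≤ E

module Submission where

-- The complete graph Kₙ has diameter 1 and Kₙ minus an edge {i, j} has diameter 2,
-- and both are unit-disc graphs, so a (2 - ε)-approximation must tell them apart.
-- With the same coins, the two runs can only differ if in Kₙ, in some step, one of
-- i, j pays for listening while the other transmits and at most two neighbours of the
-- listener transmit: with three or more, a collision remains after deleting the edge.
-- A device of energy E is therefore exposed to at most 2E other devices, so at most
-- 2nE of the n(n - 1) ordered pairs are exposed, while for all i ≠ j one of (i, j), (j, i)
-- must be exposed with probability at least 1/2.  Averaging over the coins gives E = Ω(n).

open import Defs
open import Data.Bool using (Bool; true; false; if_then_else_; not)
import Data.Bool.Properties as Bool
open import Data.Empty using (⊥)
open import Data.Fin as Fin using (Fin; zero; suc; toℕ)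
import Data.Fin.Properties as Fin
open import Data.Integer as ℤ using (-[1+_])
import Data.Integer.Properties as ℤ
open import Data.List using (List; []; _∷_; length; mapMaybe; allFin; tabulate)
open import Data.List.Membership.Propositional using (_∈_)
import Data.List.Membership.DecPropositional as DecMembership
open import Data.List.Properties using (mapMaybe-cong)
open import Data.List.Relation.Unary.All as All using (All)
open import Data.List.Relation.Unary.AllPairs using () renaming (_∷_ to _∷ᵘ_)
open import Data.List.Relation.Unary.Unique.Propositional using (Unique)
open import Data.Maybe using (Maybe; just; nothing; is-just)
open import Data.Maybe.Properties using (just-injective)
open import Data.Nat hiding (_/_)
open import Data.Nat.Properties
open import Algebra.Properties.CommutativeMonoid.Sum +-0-commutativeMonoid
  using (sum; ∑-distrib-+)
open import Data.Nat.Solver renaming (module +-*-Solver to ℕ-Solver)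
open import Data.Product using (∃-syntax; _×_; _,_; proj₁)
open import Data.Rational as ℚ using (ℚ; 0ℚ; 1ℚ; _/_; toℚᵘ)
import Data.Rational.Properties as ℚ
open import Data.Rational.Solver renaming (module +-*-Solver to ℚ-Solver)
open import Data.Rational.Unnormalised as ℚᵘ using (mkℚᵘ)
import Data.Rational.Unnormalised.Properties as ℚᵘ
open import Data.Sum using (_⊎_; inj₁; inj₂)
open import Data.Vec as Vec using (Vec; []; _∷_; truncate; lookup)
import Data.Vec.Properties as Vec
open import Function using (_∘_; mk⇔)
open import Relation.Binary.Definitions using (DecidableEquality)
open import Relation.Binary.PropositionalEquality
open import Relation.Nullary using (¬_; Dec; does; yes; no; contradiction)
open import Relation.Nullary.Decidable
  using (_×-dec_; _⊎-dec_; does-⇔; dec-true; dec-false; True; toWitness; from-no)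

-- Finite sums and counting words

⟦_⟧ : Bool → ℕ
⟦ true ⟧  = 1
⟦ false ⟧ = 0

-- Vertices, bits and coin words share this one interface. Monotonicity is pointwise, so `∑-cong`
-- follows by antisymmetry without function extensionality.
record Summation (A : Set) : Set where
  field
    ∑      : (A → ℕ) → ℕ
    ∑-+    : ∀ f g → ∑ (λ x → f x + g x) ≡ ∑ f + ∑ g
    ∑-mono : ∀ {f g} → (∀ x → f x ≤ g x) → ∑ f ≤ ∑ g
    term≤∑ : ∀ f x → f x ≤ ∑ f

  ∑-cong : ∀ {f g} → (∀ x → f x ≡ g x) → ∑ f ≡ ∑ g
  ∑-cong f≗g =
    ≤-antisym (∑-mono (≤-reflexive ∘ f≗g)) (∑-mono (≤-reflexive ∘ sym ∘ f≗g))

  ∑-zero : ∑ (λ _ → 0) ≡ 0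
  ∑-zero = +-cancelˡ-≡ (∑ (λ _ → 0)) _ _
    (trans (sym (∑-+ (λ _ → 0) (λ _ → 0))) (sym (+-identityʳ _)))

  ∑-* : ∀ c f → ∑ (λ x → c * f x) ≡ c * ∑ f
  ∑-* zero    f = ∑-zero
  ∑-* (suc c) f = trans (∑-+ f (λ x → c * f x)) (cong (∑ f +_) (∑-* c f))

  size : ℕ
  size = ∑ (λ _ → 1)

  ∑-const : ∀ c → ∑ (λ _ → c) ≡ c * size
  ∑-const c = trans (∑-cong (λ _ → sym (*-identityʳ c))) (∑-* c (λ _ → 1))

open Summation

finSummation : ∀ n → Summation (Fin n)
finSummation n = record
  { ∑ = sum ; ∑-+ = ∑-distrib-+ ; ∑-mono = mono ; term≤∑ = term }
  where
  mono : ∀ {n} {f g : Fin n → ℕ} → (∀ x → f x ≤ g x) → sum f ≤ sum g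
  mono {zero}  f≤g = z≤n
  mono {suc n} f≤g = +-mono-≤ (f≤g zero) (mono (f≤g ∘ suc))

  term : ∀ {n} (f : Fin n → ℕ) x → f x ≤ sum f
  term f zero    = m≤m+n _ _
  term f (suc x) = ≤-trans (term (f ∘ suc) x) (m≤n+m _ _)

sum-size : ∀ n → size (finSummation n) ≡ n
sum-size zero    = refl
sum-size (suc n) = cong suc (sum-size n)

sum-point : ∀ {n} (u : Fin n) → sum (λ x → ⟦ does (x Fin.≟ u) ⟧) ≡ 1
sum-point {suc n} zero    = cong suc (∑-zero (finSummation n))
sum-point {suc n} (suc u) = sum-point u

∑-sum-swap : ∀ {A} (Σᴬ : Summation A) {n} (f : Fin n → A → ℕ) →
  ∑ Σᴬ (λ a → sum (λ i → f i a)) ≡ sum (λ i → ∑ Σᴬ (f i))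
∑-sum-swap Σᴬ {zero}  f = ∑-zero Σᴬ
∑-sum-swap Σᴬ {suc n} f = trans (∑-+ Σᴬ (f zero) _)
  (cong (∑ Σᴬ (f zero) +_) (∑-sum-swap Σᴬ (f ∘ suc)))

boolSummation : Summation Bool
boolSummation = record
  { ∑      = λ f → f false + f true
  ; ∑-+    = λ f g → solve 4 (λ a b c d → (a :+ b) :+ (c :+ d) := (a :+ c) :+ (b :+ d))
               refl (f false) (g false) (f true) (g true)
  ; ∑-mono = λ f≤g → +-mono-≤ (f≤g false) (f≤g true)
  ; term≤∑ = λ { f false → m≤m+n _ _ ; f true → m≤n+m _ _ }
  }
  where open ℕ-Solver using (solve; con; _:=_; _:+_; _:*_)

vecSummation : ∀ {A} → Summation A → ∀ n → Summation (Vec A n)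
vecSummation {A} Σᴬ n = record
  { ∑ = ∑ⱽ n ; ∑-+ = +ⱽ n ; ∑-mono = monoⱽ n ; term≤∑ = termⱽ }
  where
  ∑ⱽ : ∀ n → (Vec A n → ℕ) → ℕ
  ∑ⱽ zero    f = f []
  ∑ⱽ (suc n) f = ∑ Σᴬ (λ a → ∑ⱽ n (λ v → f (a ∷ v)))

  +ⱽ : ∀ n f g → ∑ⱽ n (λ v → f v + g v) ≡ ∑ⱽ n f + ∑ⱽ n g
  +ⱽ zero    f g = refl
  +ⱽ (suc n) f g =
    trans (∑-cong Σᴬ (λ a → +ⱽ n (f ∘ (a ∷_)) (g ∘ (a ∷_)))) (∑-+ Σᴬ _ _)

  monoⱽ : ∀ n {f g} → (∀ v → f v ≤ g v) → ∑ⱽ n f ≤ ∑ⱽ n g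
  monoⱽ zero    f≤g = f≤g []
  monoⱽ (suc n) f≤g = ∑-mono Σᴬ (λ a → monoⱽ n (f≤g ∘ (a ∷_)))

  termⱽ : ∀ {n} f v → f v ≤ ∑ⱽ n f
  termⱽ f []      = ≤-refl
  termⱽ f (a ∷ v) = ≤-trans (termⱽ (f ∘ (a ∷_)) v)
    (term≤∑ Σᴬ (λ a → ∑ⱽ _ (λ v → f (a ∷ v))) a)

vec-size : ∀ {A} (Σᴬ : Summation A) n → size (vecSummation Σᴬ n) ≡ size Σᴬ ^ n
vec-size Σᴬ zero    = refl
vec-size Σᴬ (suc n) = begin
  ∑ Σᴬ (λ _ → size (vecSummation Σᴬ n))  ≡⟨ ∑-const Σᴬ _ ⟩
  size (vecSummation Σᴬ n) * size Σᴬ     ≡⟨ *-comm _ (size Σᴬ) ⟩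
  size Σᴬ * size (vecSummation Σᴬ n)     ≡⟨ cong (size Σᴬ *_) (vec-size Σᴬ n) ⟩
  size Σᴬ * size Σᴬ ^ n                  ∎
  where open ≡-Reasoning

-- Coin words and their truncation

words : ∀ m n → Summation (Vec (Vec Bool m) n)
words m = vecSummation (vecSummation boolSummation m)

words-size : ∀ m n → size (words m n) ≡ 2 ^ (n * m)
words-size m n = begin
  size (words m n)                            ≡⟨ vec-size (vecSummation boolSummation m) n ⟩
  size (vecSummation boolSummation m) ^ n     ≡⟨ cong (_^ n) (vec-size boolSummation m) ⟩
  (2 ^ m) ^ n                                 ≡⟨ ^-*-assoc 2 m n ⟩
  2 ^ (m * n)                                 ≡⟨ cong (2 ^_) (*-comm m n) ⟩
  2 ^ (n * m)                                 ∎
  where open ≡-Reasoning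

-- Every fibre of `π` has exactly `r` elements, phrased for sums: pulling an event back along `π`
-- keeps its proportion.
UniformMap : ∀ {A B} → Summation A → Summation B → (A → B) → ℕ → Set
UniformMap Σᴬ Σᴮ π r = ∀ f → ∑ Σᴬ (f ∘ π) ≡ r * ∑ Σᴮ f

-- A word of length `m` extends to length `M` in one way for each choice of the remaining `M ∸ m`
-- bits.
truncate-uniform : ∀ {m M} (m≤M : m ≤ M) →
  UniformMap (vecSummation boolSummation M) (vecSummation boolSummation m)
    (truncate m≤M) (2 ^ (M ∸ m))
truncate-uniform {M = M} z≤n f = begin
  ∑ ΣM (λ _ → f [])  ≡⟨ ∑-const ΣM (f []) ⟩
  f [] * size ΣM     ≡⟨ *-comm (f []) _ ⟩
  size ΣM * f []     ≡⟨ cong (_* f []) (vec-size boolSummation M) ⟩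
  2 ^ M * f []       ∎
  where
  open ≡-Reasoning
  ΣM = vecSummation boolSummation M
truncate-uniform (s≤s {m} {M} m≤M) f =
  trans (cong₂ _+_ (truncate-uniform m≤M (f ∘ (false ∷_))) (truncate-uniform m≤M (f ∘ (true ∷_))))
    (sym (*-distribˡ-+ (2 ^ (M ∸ m)) _ _))

-- A fibre of the coordinatewise map is a product of `n` fibres, so the multiplicities multiply.
vecMap-uniform : ∀ {A B} (Σᴬ : Summation A) (Σᴮ : Summation B) {π r} →
  UniformMap Σᴬ Σᴮ π r → ∀ n →
  UniformMap (vecSummation Σᴬ n) (vecSummation Σᴮ n) (Vec.map π) (r ^ n)
vecMap-uniform Σᴬ Σᴮ uniform zero f = sym (*-identityˡ _)
vecMap-uniform Σᴬ Σᴮ {π} {r} uniform (suc n) f = begin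
  ∑ Σᴬ (λ a → ∑ (vecSummation Σᴬ n) (λ v → f (π a ∷ Vec.map π v)))
    ≡⟨ ∑-cong Σᴬ (λ a → vecMap-uniform Σᴬ Σᴮ uniform n (f ∘ (π a ∷_))) ⟩
  ∑ Σᴬ (λ a → r ^ n * ∑ (vecSummation Σᴮ n) (λ w → f (π a ∷ w)))
    ≡⟨ ∑-* Σᴬ (r ^ n) _ ⟩
  r ^ n * ∑ Σᴬ (λ a → ∑ (vecSummation Σᴮ n) (λ w → f (π a ∷ w)))
    ≡⟨ cong (r ^ n *_) (uniform (λ b → ∑ (vecSummation Σᴮ n) (λ w → f (b ∷ w)))) ⟩
  r ^ n * (r * ∑ (vecSummation Σᴮ (suc n)) f)
    ≡⟨ solve 3 (λ x y z → x :* (y :* z) := (y :* x) :* z) refl (r ^ n) r _ ⟩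
  r ^ suc n * ∑ (vecSummation Σᴮ (suc n)) f  ∎
  where
  open ≡-Reasoning
  open ℕ-Solver using (solve; con; _:=_; _:+_; _:*_)

module _ {A : Set} (_≟_ : DecidableEquality A) (Σᴬ : Summation A) where
  open DecMembership _≟_ using (_∈?_)

  -- Peel off the head: its indicator has sum at least 1 and, by uniqueness, does not overlap the
  -- indicator of the tail.
  unique-length≤∑ : ∀ xs → Unique xs → length xs ≤ ∑ Σᴬ (λ x → ⟦ does (x ∈? xs) ⟧)
  unique-length≤∑ []       _              = z≤n
  unique-length≤∑ (y ∷ ys) (y≢ys ∷ᵘ uniq) = begin
    1 + length ys
      ≤⟨ +-mono-≤ self (unique-length≤∑ ys uniq) ⟩
    ∑ Σᴬ (λ x → ⟦ does (x ≟ y) ⟧) + ∑ Σᴬ (λ x → ⟦ does (x ∈? ys) ⟧)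
      ≡⟨ sym (∑-+ Σᴬ _ _) ⟩
    ∑ Σᴬ (λ x → ⟦ does (x ≟ y) ⟧ + ⟦ does (x ∈? ys) ⟧)
      ≤⟨ ∑-mono Σᴬ disjoint ⟩
    ∑ Σᴬ (λ x → ⟦ does (x ∈? (y ∷ ys)) ⟧) ∎
    where
    open ≤-Reasoning
    self : 1 ≤ ∑ Σᴬ (λ x → ⟦ does (x ≟ y) ⟧)
    self with y ≟ y | term≤∑ Σᴬ (λ x → ⟦ does (x ≟ y) ⟧) y
    ... | yes _  | le = le
    ... | no y≢y | _  = contradiction refl y≢y

    disjoint : ∀ x → ⟦ does (x ≟ y) ⟧ + ⟦ does (x ∈? ys) ⟧ ≤ ⟦ does (x ∈? (y ∷ ys)) ⟧
    disjoint x with x ≟ y | x ∈? ys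
    ... | yes refl | yes x∈ys = contradiction refl (All.lookup y≢ys x∈ys)
    ... | yes _    | no _     = ≤-refl
    ... | no _     | yes _    = ≤-refl
    ... | no _     | no _     = ≤-refl

-- Runs after deleting an edge

length-mapMaybe-tabulate : ∀ {A B : Set} {n} (f : A → Maybe B) (g : Fin n → A) →
  length (mapMaybe f (tabulate g)) ≡ sum (λ x → ⟦ is-just (f (g x)) ⟧)
length-mapMaybe-tabulate {n = zero}  f g = refl
length-mapMaybe-tabulate {n = suc n} f g with f (g zero)
... | just _  = cong suc (length-mapMaybe-tabulate f (g ∘ suc))
... | nothing = length-mapMaybe-tabulate f (g ∘ suc)

length-mapMaybe-allFin : ∀ {A : Set} {n} (f : Fin n → Maybe A) →
  length (mapMaybe f (allFin n)) ≡ sum (λ x → ⟦ is-just (f x) ⟧)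
length-mapMaybe-allFin f = length-mapMaybe-tabulate f (λ x → x)

-- One changed position accounts for at most one entry. It is applied with `u` as the far end of the
-- deleted edge: the listener loses at most one message.
length-mapMaybe-change : ∀ {A : Set} {n} (f g : Fin n → Maybe A) u →
  (∀ x → x ≢ u → f x ≡ g x) →
  length (mapMaybe f (allFin n)) ≤ suc (length (mapMaybe g (allFin n)))
length-mapMaybe-change {n = n} f g u agree = begin
  length (mapMaybe f (allFin n))
    ≡⟨ length-mapMaybe-allFin f ⟩
  sum (λ x → ⟦ is-just (f x) ⟧)
    ≤⟨ ∑-mono (finSummation n) pointwise ⟩
  sum (λ x → ⟦ does (x Fin.≟ u) ⟧ + ⟦ is-just (g x) ⟧)
    ≡⟨ ∑-+ (finSummation n) (λ x → ⟦ does (x Fin.≟ u) ⟧) _ ⟩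
  sum (λ x → ⟦ does (x Fin.≟ u) ⟧) + sum (λ x → ⟦ is-just (g x) ⟧)
    ≡⟨ cong₂ _+_ (sum-point u) (sym (length-mapMaybe-allFin g)) ⟩
  suc (length (mapMaybe g (allFin n))) ∎
  where
  open ≤-Reasoning
  indicator≤1 : ∀ b → ⟦ b ⟧ ≤ 1
  indicator≤1 true  = ≤-refl
  indicator≤1 false = z≤n
  pointwise : ∀ x → ⟦ is-just (f x) ⟧ ≤ ⟦ does (x Fin.≟ u) ⟧ + ⟦ is-just (g x) ⟧
  pointwise x with x Fin.≟ u
  ... | yes _  = ≤-trans (indicator≤1 (is-just (f x))) (m≤m+n 1 _)
  ... | no x≢u = ≤-reflexive (cong (⟦_⟧ ∘ is-just) (agree x x≢u))

-- From two messages on, the feedback no longer depends on the messages: silence in `RN`, noise in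
-- `RN-CD`. This lets one argument serve both models.
perceive-collision : ∀ μ {xs ys} → 2 ≤ length xs → 2 ≤ length ys →
  perceive μ xs ≡ perceive μ ys
perceive-collision RN    {_ ∷ _ ∷ _} {_ ∷ _ ∷ _} _ _ = refl
perceive-collision RN-CD {_ ∷ _ ∷ _} {_ ∷ _ ∷ _} _ _ = refl
perceive-collision _ {_ ∷ []} (s≤s ())
perceive-collision _ {_ ∷ _ ∷ _} {_ ∷ []} _ (s≤s ())

module _ (P : Protocol) where

  advance-energy : ∀ f d → energy d ≤ energy (advance P f d)
  advance-energy f (halted x e) = ≤-refl
  advance-energy f (running s tape e) with chosenMove P s tape
  ... | halt x        = ≤-refl
  ... | idle s′       = ≤-refl
  ... | listen k      = n≤1+n e
  ... | transmit _ s′ = n≤1+n e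

  -- Only `listen` looks at its feedback, and it costs a unit of energy.
  advance-free : ∀ f g d → energy (advance P f d) ≤ energy d →
    advance P f d ≡ advance P g d
  advance-free f g (halted x e) _ = refl
  advance-free f g (running s tape e) le with chosenMove P s tape
  ... | halt x        = refl
  ... | idle s′       = refl
  ... | listen k      = contradiction le 1+n≰n
  ... | transmit _ s′ = refl

  advance-output : ∀ f d {x} → output d ≡ just x → output (advance P f d) ≡ just x
  advance-output f (halted x e) eq = eq

module _ {n : ℕ} (G : Graph n) (i j : Fin n) where

  Endpoints : Fin n → Fin n → Set
  Endpoints u v = (u ≡ i × v ≡ j) ⊎ (u ≡ j × v ≡ i)

  endpoints? : ∀ u v → Dec (Endpoints u v)
  endpoints? u v =
    ((u Fin.≟ i) ×-dec (v Fin.≟ j)) ⊎-dec ((u Fin.≟ j) ×-dec (v Fin.≟ i))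

  endpoints-swap : ∀ {u v} → Endpoints u v → Endpoints v u
  endpoints-swap (inj₁ (u≡i , v≡j)) = inj₂ (v≡j , u≡i)
  endpoints-swap (inj₂ (u≡j , v≡i)) = inj₁ (v≡i , u≡j)

  deleteEdge : Graph n
  deleteEdge = record
    { adj       = λ u v → if does (endpoints? u v) then false else adj G u v
    ; symmetric = λ u v → cong₂ (λ b c → if b then false else c)
        (does-⇔ (mk⇔ endpoints-swap endpoints-swap) (endpoints? u v) (endpoints? v u))
        (symmetric G u v)
    ; loopless  = λ v → loop (does (endpoints? v v)) (loopless G v)
    }
    where
    loop : ∀ b {c} → c ≡ false → (if b then false else c) ≡ false
    loop true  _  = refl
    loop false eq = eq

  adj-deleted : ∀ {u v} → Endpoints u v → adj deleteEdge u v ≡ false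
  adj-deleted {u} {v} e rewrite dec-true (endpoints? u v) e = refl

  adj-kept : ∀ {u v} → ¬ Endpoints u v → adj deleteEdge u v ≡ adj G u v
  adj-kept {u} {v} ¬e rewrite dec-false (endpoints? u v) ¬e = refl

-- Exposure of a device to its neighbours

module _ (P : Protocol) (μ : Model) {n : ℕ} (G : Graph n) (ω : Coins n) where

  received : Graph n → (Fin n → Device (State P)) → Fin n → Fin n → Maybe Message
  received H devices v u = if adj H v u then sent P (devices u) else nothing

  -- A halted device is frozen. Hence outputs reached at different times in two runs can be compared
  -- at a common later time.
  output-stable : ∀ {t T} → t ≤ T → ∀ {v x} →
    output (run P μ G ω t v) ≡ just x → output (run P μ G ω T v) ≡ just x
  output-stable {t} t≤T {v} {x} eq = go (≤⇒≤′ t≤T)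
    where
    go : ∀ {T} → t ≤′ T → output (run P μ G ω T v) ≡ just x
    go ≤′-refl       = eq
    go (≤′-step {T} t≤T) =
      advance-output P (perceive μ (heard P μ G (run P μ G ω T) v)) (run P μ G ω T v) (go t≤T)

  -- The truncated subtraction is exact by `advance-energy`, so these terms telescope to the energy.
  cost : ℕ → Fin n → ℕ
  cost t v = energy (run P μ G ω (suc t) v) ∸ energy (run P μ G ω t v)

  -- The threshold is 2, not 1: removing one of two messages turns a collision into a reception,
  -- while removing one of three leaves a collision.
  quiet : ℕ → Fin n → ℕ
  quiet t v = ⟦ does (length (heard P μ G (run P μ G ω t) v) ≤? 2) ⟧

  -- A number rather than a predicate, so that it can be summed over senders, time and coins. Where
  -- it vanishes, `v` cannot tell in this step whether the edge to `u` is present.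
  influence : ℕ → Fin n → Fin n → ℕ
  influence t v u = cost t v * quiet t v * ⟦ is-just (received G (run P μ G ω t) v u) ⟧

  exposure : ℕ → Fin n → Fin n → ℕ
  exposure zero    v u = 0
  exposure (suc T) v u = exposure T v u + influence T v u

  -- The factor `quiet` leaves at most two senders, so each paid step is charged at most twice.
  sum-influence : ∀ t v → sum (influence t v) ≤ 2 * cost t v
  sum-influence t v = begin
    sum (influence t v)
      ≡⟨ ∑-* (finSummation n) (cost t v * quiet t v)
           (λ u → ⟦ is-just (received G (run P μ G ω t) v u) ⟧) ⟩
    cost t v * quiet t v * sum (λ u → ⟦ is-just (received G (run P μ G ω t) v u) ⟧)
      ≡⟨ cong (cost t v * quiet t v *_)
           (sym (length-mapMaybe-allFin (received G (run P μ G ω t) v))) ⟩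
    cost t v * quiet t v * length messages
      ≡⟨ *-assoc (cost t v) _ _ ⟩
    cost t v * (quiet t v * length messages)
      ≤⟨ *-monoʳ-≤ (cost t v) bound ⟩
    cost t v * 2
      ≡⟨ *-comm (cost t v) 2 ⟩
    2 * cost t v ∎
    where
    open ≤-Reasoning
    messages = heard P μ G (run P μ G ω t) v
    bound : quiet t v * length messages ≤ 2
    bound = small (length messages)
      where
      small : ∀ l → ⟦ does (l ≤? 2) ⟧ * l ≤ 2
      small 0                   = z≤n
      small 1                   = s≤s z≤n
      small 2                   = s≤s (s≤s z≤n)
      small (suc (suc (suc _))) = z≤n

  sum-exposure : ∀ T v → sum (exposure T v) ≤ 2 * energy (run P μ G ω T v)
  sum-exposure zero    v = ≤-reflexive (∑-zero (finSummation n))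
  sum-exposure (suc T) v = begin
    sum (exposure (suc T) v)
      ≡⟨ ∑-+ (finSummation n) (exposure T v) (influence T v) ⟩
    sum (exposure T v) + sum (influence T v)
      ≤⟨ +-mono-≤ (sum-exposure T v) (sum-influence T v) ⟩
    2 * energy (run P μ G ω T v) + 2 * cost T v
      ≡⟨ sym (*-distribˡ-+ 2 (energy (run P μ G ω T v)) _) ⟩
    2 * (energy (run P μ G ω T v) + cost T v)
      ≡⟨ cong (2 *_) (m+[n∸m]≡n (advance-energy P _ (run P μ G ω T v))) ⟩
    2 * energy (run P μ G ω (suc T) v) ∎
    where open ≤-Reasoning

  -- If u transmits and v pays for the step, a zero influence means that at least
  -- three messages reach v, so removing u still leaves a collision.
  advance-without : ∀ t v u H → influence t v u ≡ 0 →
    adj H v u ≡ false → (∀ x → x ≢ u → adj H v x ≡ adj G v x) →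
    advance P (perceive μ (heard P μ H (run P μ G ω t) v)) (run P μ G ω t v) ≡
    run P μ G ω (suc t) v
  advance-without t v u H none deleted kept =
    byCase (received G devices v u) refl (length (mapMaybe f (allFin n)) ≤? 2) refl
    where
    devices = run P μ G ω t
    f = received G devices v
    g = received H devices v

    agree : ∀ x → x ≢ u → g x ≡ f x
    agree x x≢u = cong (λ b → if b then sent P (devices x) else nothing) (kept x x≢u)

    missing : g u ≡ nothing
    missing = cong (λ b → if b then sent P (devices u) else nothing) deleted

    Goal = advance P (perceive μ (mapMaybe g (allFin n))) (devices v) ≡
           advance P (perceive μ (mapMaybe f (allFin n))) (devices v)

    byCase : ∀ m → f u ≡ m →
      (small? : Dec (length (mapMaybe f (allFin n)) ≤ 2)) →
      (length (mapMaybe f (allFin n)) ≤? 2) ≡ small? → Goal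
    -- `u` contributes no message to `v`, so the lists heard with and without the edge coincide.
    byCase nothing fu _ _ =
      cong (λ ms → advance P (perceive μ ms) (devices v)) (mapMaybe-cong same (allFin n))
      where
      same : ∀ x → g x ≡ f x
      same x with x Fin.≟ u
      ... | yes refl = trans missing (sym fu)
      ... | no x≢u   = agree x x≢u
    -- Both indicator factors are 1, so zero influence forces zero cost, and a step without cost
    -- ignores the feedback.
    byCase (just m) fu (yes small) eq =
      sym (advance-free P _ _ (devices v) (m∸n≡0⇒m≤n free))
      where
      open ≡-Reasoning
      free : cost t v ≡ 0
      free = begin
        cost t v                                ≡⟨ sym (trans (*-identityʳ _) (*-identityʳ _)) ⟩
        cost t v * ⟦ true ⟧ * ⟦ is-just (just m) ⟧
          ≡⟨ cong₂ (λ d r → cost t v * ⟦ does d ⟧ * ⟦ is-just r ⟧) (sym eq) (sym fu) ⟩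
        influence t v u                         ≡⟨ none ⟩
        0                                       ∎
    byCase (just m) fu (no large) _ =
      cong (λ fb → advance P fb (devices v))
        (perceive-collision μ
          (s≤s⁻¹ (≤-trans (≰⇒> large) (length-mapMaybe-change f g u (λ x → sym ∘ agree x))))
          (<⇒≤ (≰⇒> large)))

module _ (P : Protocol) (μ : Model) {n : ℕ} (G : Graph n) (ω : Coins n) (i j : Fin n) where

  private
    G-ij = deleteEdge G i j

  heard-cong : ∀ (H : Graph n) {devices devices′} → (∀ v → devices v ≡ devices′ v) →
    ∀ v → heard P μ H devices v ≡ heard P μ H devices′ v
  heard-cong H eq v = mapMaybe-cong
    (λ u → cong (λ d → if adj H v u then sent P d else nothing) (eq u)) (allFin n)

  -- Induction on time. Exposure accumulates, so its vanishing passes to earlier times and to the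
  -- influence of the last step. Only `i` and `j` have changed neighbourhoods, and `advance-without`
  -- handles each of them.
  run-deleteEdge : ∀ T → exposure P μ G ω T i j ≡ 0 → exposure P μ G ω T j i ≡ 0 →
    ∀ v → run P μ G-ij ω T v ≡ run P μ G ω T v
  run-deleteEdge zero    _  _  v = refl
  run-deleteEdge (suc T) ij ji v =
    trans (cong₂ (λ ms d → advance P (perceive μ ms) d) (heard-cong G-ij before v) (before v))
      after
    where
    before : ∀ v → run P μ G-ij ω T v ≡ run P μ G ω T v
    before = run-deleteEdge T (m+n≡0⇒m≡0 _ ij) (m+n≡0⇒m≡0 _ ji)

    after : advance P (perceive μ (heard P μ G-ij (run P μ G ω T) v)) (run P μ G ω T v) ≡
            run P μ G ω (suc T) v
    after = byCase (v Fin.≟ i) (v Fin.≟ j)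
      where
      byCase : Dec (v ≡ i) → Dec (v ≡ j) →
        advance P (perceive μ (heard P μ G-ij (run P μ G ω T) v)) (run P μ G ω T v) ≡
        run P μ G ω (suc T) v
      byCase (yes refl) _ = advance-without P μ G ω T i j G-ij
        (m+n≡0⇒n≡0 (exposure P μ G ω T i j) ij)
        (adj-deleted G i j (inj₁ (refl , refl)))
        (λ x x≢j → adj-kept G i j λ
          { (inj₁ (_ , x≡j)) → x≢j x≡j ; (inj₂ (i≡j , x≡i)) → x≢j (trans x≡i i≡j) })
      byCase (no _) (yes refl) = advance-without P μ G ω T j i G-ij
        (m+n≡0⇒n≡0 (exposure P μ G ω T j i) ji)
        (adj-deleted G i j (inj₂ (refl , refl)))
        (λ x x≢i → adj-kept G i j λ
          { (inj₁ (j≡i , x≡j)) → x≢i (trans x≡j j≡i) ; (inj₂ (_ , x≡i)) → x≢i x≡i })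
      byCase (no v≢i) (no v≢j) = cong (λ ms → advance P (perceive μ ms) (run P μ G ω T v))
        (mapMaybe-cong
          (λ u → cong (λ b → if b then sent P (run P μ G ω T u) else nothing)
            (adj-kept G i j {v} {u} λ
              { (inj₁ (v≡i , _)) → v≢i v≡i ; (inj₂ (v≡j , _)) → v≢j v≡j }))
          (allFin n))

-- The two unit-disc graphs

complete : ∀ n → Graph n
complete n = record
  { adj       = λ u v → not (does (u Fin.≟ v))
  ; symmetric = λ u v → cong not (does-⇔ (mk⇔ sym sym) (u Fin.≟ v) (v Fin.≟ u))
  ; loopless  = λ v → cong not (dec-true (v Fin.≟ v) refl)
  }

complete-adj : ∀ {n} {u v : Fin n} → u ≢ v → adj (complete n) u v ≡ true
complete-adj {u = u} {v} u≢v = cong not (dec-false (u Fin.≟ v) u≢v)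

adj⇒≢ : ∀ {n} (G : Graph n) {u v} → adj G u v ≡ true → u ≢ v
adj⇒≢ G uv refl with () ← trans (sym uv) (loopless G _)

complete-walk : ∀ {n} (u v : Fin n) → ∃[ k ] (k ≤ 1 × Walk (complete n) u v k)
complete-walk u v with u Fin.≟ v
... | yes refl = 0 , z≤n , stop
... | no u≢v   = 1 , s≤s z≤n , step (complete-adj u≢v) stop

complete-connected : ∀ n → Connected (complete n)
complete-connected n u v with k , _ , walk ← complete-walk u v = k , walk

complete-diameter : ∀ {n D} → IsDiameter (complete n) D → D ≤ 1
complete-diameter (_ , u , v , _ , shortest) with k , k≤1 , walk ← complete-walk u v =
  ≤-trans (shortest k walk) k≤1

-- Supplies a common neighbour of the two ends of the deleted edge, which keeps the graph connected.
third : ∀ {n} (u v : Fin (3 + n)) → ∃[ w ] (w ≢ u × w ≢ v)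
third zero          zero          = suc zero       , (λ ()) , (λ ())
third zero          (suc zero)    = suc (suc zero) , (λ ()) , (λ ())
third zero          (suc (suc _)) = suc zero       , (λ ()) , (λ ())
third (suc zero)    zero          = suc (suc zero) , (λ ()) , (λ ())
third (suc (suc _)) zero          = suc zero       , (λ ()) , (λ ())
third (suc _)       (suc _)       = zero           , (λ ()) , (λ ())

module _ {n : ℕ} (i j : Fin n) where

  almostComplete : Graph n
  almostComplete = deleteEdge (complete n) i j

  almostComplete-adj : ∀ {u v} → u ≢ v → ¬ Endpoints (complete n) i j u v →
    adj almostComplete u v ≡ true
  almostComplete-adj u≢v ¬e = trans (adj-kept (complete n) i j ¬e) (complete-adj u≢v)

  almostComplete-diameter : i ≢ j → ∀ {D} → IsDiameter almostComplete D → 2 ≤ D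
  almostComplete-diameter i≢j (close , _) with close i j
  ... | 0           , _   , stop , _         = contradiction refl i≢j
  ... | 1           , _   , step ij stop , _
    with () ← trans (sym ij) (adj-deleted (complete n) i j (inj₁ (refl , refl)))
  ... | suc (suc d) , d≤D , _ , _            = ≤-trans (s≤s (s≤s z≤n)) d≤D

almostComplete-connected : ∀ {n} (i j : Fin (3 + n)) → Connected (almostComplete i j)
almostComplete-connected {n} i j u v with u Fin.≟ v
... | yes refl = 0 , stop
... | no u≢v with endpoints? (complete (3 + n)) i j u v
... | no ¬e = 1 , step (almostComplete-adj i j u≢v ¬e) stop
... | yes e with w , w≢i , w≢j ← third i j =
  2 , step (almostComplete-adj i j (≢w e ∘ sym) (avoidʳ ∘ endpoints-swap G i j))
        (step (almostComplete-adj i j (≢w (endpoints-swap G i j e)) avoidʳ) stop)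
  where
  G = complete (3 + n)
  avoidʳ : ∀ {x} → ¬ Endpoints G i j w x
  avoidʳ (inj₁ (w≡i , _)) = w≢i w≡i
  avoidʳ (inj₂ (w≡j , _)) = w≢j w≡j
  ≢w : ∀ {x y} → Endpoints G i j x y → w ≢ x
  ≢w (inj₁ (refl , _)) = w≢i
  ≢w (inj₂ (refl , _)) = w≢j

-- Disc representations with centres on a line

≤ℝ-pointwise : ∀ {x y} → (∀ i → approx x i ℚ.≤ approx y i) → x ≤ℝ y
≤ℝ-pointwise {x} {y} x≤y ε 0<ε = 0 , λ i _ →
  subst (ℚ._≤ approx y i ℚ.+ ε) (ℚ.+-identityʳ (approx x i))
    (ℚ.+-mono-≤ (x≤y i) (ℚ.<⇒≤ 0<ε))

onAxis : ℚ → Point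
onAxis a = point (fromℚ a) (fromℚ 0ℚ)

-- At concrete rationals the distance test evaluates, which fills the implicit argument.
inUnitDisc : ∀ a p →
  {True ((p ℚ.- a) ℚ.* (p ℚ.- a) ℚ.+ (0ℚ ℚ.- 0ℚ) ℚ.* (0ℚ ℚ.- 0ℚ) ℚ.≤? 1ℚ)} →
  InUnitDisc (onAxis a) (onAxis p)
inUnitDisc a p {close} = ≤ℝ-pointwise
  {x = (fromℚ p -ℝ fromℚ a) *ℝ (fromℚ p -ℝ fromℚ a) +ℝ
       (fromℚ 0ℚ -ℝ fromℚ 0ℚ) *ℝ (fromℚ 0ℚ -ℝ fromℚ 0ℚ)}
  {y = fromℕ 1} (λ _ → toWitness close)

complete-isUnitDisc : ∀ n → IsUnitDisc (complete n)
complete-isUnitDisc n = (λ _ → onAxis 0ℚ) , λ u v → mk⇔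
  (λ uv → adj⇒≢ (complete n) uv , onAxis 0ℚ , centred , centred)
  (λ (u≢v , _) → complete-adj u≢v)
  where
  centred = inUnitDisc 0ℚ 0ℚ

-2ℚ 2ℚ -1ℚ : ℚ
-2ℚ = -[1+ 1 ] / 1
2ℚ  = ℤ.+ 2 / 1
-1ℚ = -[1+ 0 ] / 1

square-nonNeg : ∀ p → 0ℚ ℚ.≤ p ℚ.* p
square-nonNeg p with ℚ.≤-total 0ℚ p
... | inj₁ 0≤p = subst (ℚ._≤ p ℚ.* p) (ℚ.*-zeroˡ p)
  (ℚ.*-monoʳ-≤-nonNeg p {{ℚ.nonNegative 0≤p}} 0≤p)
... | inj₂ p≤0 = subst (ℚ._≤ p ℚ.* p) (ℚ.*-zeroˡ p)
  (ℚ.*-monoʳ-≤-nonPos p {{ℚ.nonPositive p≤0}} p≤0)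

-- Add the two disc inequalities at an approximant (a, b) of the point. The left sides sum to 8 +
-- 2a² + 2b², the right sides to 4 when each real inequality is used with slack 1.
far-apart : ∀ p → InUnitDisc (onAxis -2ℚ) p → InUnitDisc (onAxis 2ℚ) p → ⊥
far-apart (point (real x _) (real y _)) near-2 near2
  with M , hM ← near-2 1ℚ (ℚ.positive⁻¹ 1ℚ) | N , hN ← near2 1ℚ (ℚ.positive⁻¹ 1ℚ) =
  from-no ((ℤ.+ 8 / 1) ℚ.≤? (ℤ.+ 4 / 1)) (begin
    ℤ.+ 8 / 1
      ≡⟨ sym (ℚ.+-identityʳ _) ⟩
    ℤ.+ 8 / 1 ℚ.+ 0ℚ
      ≤⟨ ℚ.+-monoʳ-≤ (ℤ.+ 8 / 1) (ℚ.+-mono-≤ (squares a) (squares b)) ⟩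
    ℤ.+ 8 / 1 ℚ.+ ((a ℚ.* a ℚ.+ a ℚ.* a) ℚ.+ (b ℚ.* b ℚ.+ b ℚ.* b))
      ≡⟨ parallelogram a b ⟩
    ((a ℚ.- -2ℚ) ℚ.* (a ℚ.- -2ℚ) ℚ.+ (b ℚ.- 0ℚ) ℚ.* (b ℚ.- 0ℚ)) ℚ.+
    ((a ℚ.- 2ℚ) ℚ.* (a ℚ.- 2ℚ) ℚ.+ (b ℚ.- 0ℚ) ℚ.* (b ℚ.- 0ℚ))
      ≤⟨ ℚ.+-mono-≤ (hM k (m≤m⊔n M N)) (hN k (m≤n⊔m M N)) ⟩
    ℤ.+ 4 / 1 ∎)
  where
  open ℚ.≤-Reasoning
  k = M ⊔ N
  a = x k
  b = y k
  squares : ∀ c → 0ℚ ℚ.≤ c ℚ.* c ℚ.+ c ℚ.* c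
  squares c = ℚ.+-mono-≤ (square-nonNeg c) (square-nonNeg c)
  parallelogram : ∀ a b →
    ℤ.+ 8 / 1 ℚ.+ ((a ℚ.* a ℚ.+ a ℚ.* a) ℚ.+ (b ℚ.* b ℚ.+ b ℚ.* b)) ≡
    ((a ℚ.- -2ℚ) ℚ.* (a ℚ.- -2ℚ) ℚ.+ (b ℚ.- 0ℚ) ℚ.* (b ℚ.- 0ℚ)) ℚ.+
    ((a ℚ.- 2ℚ) ℚ.* (a ℚ.- 2ℚ) ℚ.+ (b ℚ.- 0ℚ) ℚ.* (b ℚ.- 0ℚ))
  parallelogram = solve 2
    (λ a b → con (ℤ.+ 8 / 1) :+ ((a :* a :+ a :* a) :+ (b :* b :+ b :* b)) :=
      ((a :- con -2ℚ) :* (a :- con -2ℚ) :+ (b :- con 0ℚ) :* (b :- con 0ℚ)) :+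
      ((a :- con 2ℚ) :* (a :- con 2ℚ) :+ (b :- con 0ℚ) :* (b :- con 0ℚ))) refl
    where open ℚ-Solver

-- `i` is put at -2, `j` at 2 and all other vertices at 0. Closed unit discs with centres at
-- distance 2 touch in one point, here -1 or 1; at distance 4 they are disjoint.
data Side : Set where
  left middle right : Side

abscissa : Side → ℚ
abscissa left   = -2ℚ
abscissa middle = 0ℚ
abscissa right  = 2ℚ

CommonPoint : ℚ → ℚ → Set
CommonPoint a b = ∃[ p ] (InUnitDisc (onAxis a) p × InUnitDisc (onAxis b) p)

commonPoint : ∀ s s′ → CommonPoint (abscissa s) (abscissa s′) ⊎
  ((s ≡ left × s′ ≡ right) ⊎ (s ≡ right × s′ ≡ left))
commonPoint left   right  = inj₂ (inj₁ (refl , refl))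
commonPoint right  left   = inj₂ (inj₂ (refl , refl))
commonPoint left   left   = inj₁ (onAxis -1ℚ , inUnitDisc -2ℚ -1ℚ , inUnitDisc -2ℚ -1ℚ)
commonPoint left   middle = inj₁ (onAxis -1ℚ , inUnitDisc -2ℚ -1ℚ , inUnitDisc 0ℚ -1ℚ)
commonPoint middle left   = inj₁ (onAxis -1ℚ , inUnitDisc 0ℚ -1ℚ , inUnitDisc -2ℚ -1ℚ)
commonPoint middle middle = inj₁ (onAxis 0ℚ , inUnitDisc 0ℚ 0ℚ , inUnitDisc 0ℚ 0ℚ)
commonPoint middle right  = inj₁ (onAxis 1ℚ , inUnitDisc 0ℚ 1ℚ , inUnitDisc 2ℚ 1ℚ)
commonPoint right  middle = inj₁ (onAxis 1ℚ , inUnitDisc 2ℚ 1ℚ , inUnitDisc 0ℚ 1ℚ)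
commonPoint right  right  = inj₁ (onAxis 1ℚ , inUnitDisc 2ℚ 1ℚ , inUnitDisc 2ℚ 1ℚ)

module _ {n : ℕ} {i j : Fin n} (i≢j : i ≢ j) where

  side : Fin n → Side
  side u with u Fin.≟ i | u Fin.≟ j
  ... | yes _ | _     = left
  ... | no _  | yes _ = right
  ... | no _  | no _  = middle

  side-left : ∀ {u} → side u ≡ left → u ≡ i
  side-left {u} eq with u Fin.≟ i | u Fin.≟ j
  ... | yes u≡i | _ = u≡i
  side-left () | no _ | yes _
  side-left () | no _ | no _

  side-right : ∀ {u} → side u ≡ right → u ≡ j
  side-right {u} eq with u Fin.≟ i | u Fin.≟ j
  ... | no _ | yes u≡j = u≡j
  side-right () | yes _ | _
  side-right () | no _ | no _

  side-i : side i ≡ left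
  side-i with i Fin.≟ i | i Fin.≟ j
  ... | yes _  | _ = refl
  ... | no i≢i | _ = contradiction refl i≢i

  side-j : side j ≡ right
  side-j with j Fin.≟ i | j Fin.≟ j
  ... | yes j≡i | _      = contradiction (sym j≡i) i≢j
  ... | no _    | yes _  = refl
  ... | no _    | no j≢j = contradiction refl j≢j

  almostComplete-isUnitDisc : IsUnitDisc (almostComplete i j)
  almostComplete-isUnitDisc = (onAxis ∘ abscissa ∘ side) , λ u v → mk⇔ (to u v) (from u v)
    where
    G = complete n

    Meet : Fin n → Fin n → Set
    Meet u v = CommonPoint (abscissa (side u)) (abscissa (side v))

    i-j-apart : ¬ Meet i j
    i-j-apart rewrite side-i | side-j = λ (p , near-2 , near2) → far-apart p near-2 near2

    to : ∀ u v → adj (almostComplete i j) u v ≡ true → u ≢ v × Meet u v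
    to u v uv = adj⇒≢ (almostComplete i j) uv , meet (commonPoint (side u) (side v))
      where
      notEndpoints : ¬ Endpoints G i j u v
      notEndpoints e with () ← trans (sym uv) (adj-deleted G i j e)
      meet : Meet u v ⊎ ((side u ≡ left × side v ≡ right) ⊎ (side u ≡ right × side v ≡ left)) →
        Meet u v
      meet (inj₁ m)              = m
      meet (inj₂ (inj₁ (l , r))) = contradiction (inj₁ (side-left l , side-right r)) notEndpoints
      meet (inj₂ (inj₂ (r , l))) = contradiction (inj₂ (side-right r , side-left l)) notEndpoints

    from : ∀ u v → u ≢ v × Meet u v → adj (almostComplete i j) u v ≡ true
    from u v (u≢v , meet) = almostComplete-adj i j u≢v λ
      { (inj₁ (refl , refl)) → i-j-apart meet
      ; (inj₂ (refl , refl)) → let p , near2 , near-2 = meet in i-j-apart (p , near-2 , near2) }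

-- Approximate values and probabilities

/1-mono-≤ : ∀ {a b} → a ≤ b → (ℤ.+ a / 1) ℚ.≤ (ℤ.+ b / 1)
/1-mono-≤ {a} {b} a≤b = ℚ.toℚᵘ-cancel-≤ (begin
  toℚᵘ (ℤ.+ a / 1)  ≃⟨ ℚ.toℚᵘ-fromℚᵘ (mkℚᵘ (ℤ.+ a) 0) ⟩
  mkℚᵘ (ℤ.+ a) 0    ≤⟨ ℚᵘ.*≤* (ℤ.*-monoʳ-≤-nonNeg (ℤ.+ 1) (ℤ.+≤+ a≤b)) ⟩
  mkℚᵘ (ℤ.+ b) 0    ≃⟨ ℚ.toℚᵘ-fromℚᵘ (mkℚᵘ (ℤ.+ b) 0) ⟨
  toℚᵘ (ℤ.+ b / 1)  ∎)
  where open ℚᵘ.≤-Reasoning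

-- Two events of probability at least 3/4 occur together with probability at least 1/2. `¼` bounds
-- the failure probability and is also the factor in the error δ/4.
¾ ¼ : ℚ
¾ = ℤ.+ 3 / 4
¼ = ℤ.+ 1 / 4

¾-cancel : ∀ a b → ¾ ℚ.* (ℤ.+ a / 1) ℚ.≤ (ℤ.+ b / 1) → 3 * a ≤ 4 * b
¾-cancel a b le = ℤ.drop‿+≤+ (subst₂ ℤ._≤_ eq₁ eq₂ (ℚᵘ.drop-*≤* lemma))
  where
  open ℚᵘ.≤-Reasoning
  lemma : mkℚᵘ (ℤ.+ 3) 3 ℚᵘ.* mkℚᵘ (ℤ.+ a) 0 ℚᵘ.≤ mkℚᵘ (ℤ.+ b) 0
  lemma = begin
    mkℚᵘ (ℤ.+ 3) 3 ℚᵘ.* mkℚᵘ (ℤ.+ a) 0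
      ≃⟨ ℚᵘ.*-congˡ {mkℚᵘ (ℤ.+ 3) 3} (ℚᵘ.≃-sym (ℚ.toℚᵘ-fromℚᵘ (mkℚᵘ (ℤ.+ a) 0))) ⟩
    toℚᵘ ¾ ℚᵘ.* toℚᵘ (ℤ.+ a / 1)        ≃⟨ ℚ.toℚᵘ-homo-* ¾ (ℤ.+ a / 1) ⟨
    toℚᵘ (¾ ℚ.* (ℤ.+ a / 1))           ≤⟨ ℚ.toℚᵘ-mono-≤ le ⟩
    toℚᵘ (ℤ.+ b / 1)                   ≃⟨ ℚ.toℚᵘ-fromℚᵘ (mkℚᵘ (ℤ.+ b) 0) ⟩
    mkℚᵘ (ℤ.+ b) 0                     ∎
  eq₁ : (ℤ.+ 3 ℤ.* ℤ.+ a) ℤ.* ℤ.+ 1 ≡ ℤ.+ (3 * a)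
  eq₁ = trans (ℤ.*-identityʳ _) (sym (ℤ.pos-* 3 a))
  eq₂ : ℤ.+ b ℤ.* ℤ.+ 4 ≡ ℤ.+ (4 * b)
  eq₂ = trans (sym (ℤ.pos-* b 4)) (cong ℤ.+_ (*-comm b 4))

¾<1- : ∀ C d .{{_ : NonZero d}} → 4 * C < d → ¾ ℚ.< 1ℚ ℚ.- (ℤ.+ C / d)
¾<1- C d@(suc d-1) 4C<d = ℚ.+-monoʳ-< 1ℚ (ℚ.neg-antimono-< small)
  where
  open ℚᵘ.≤-Reasoning
  small : (ℤ.+ C / d) ℚ.< ¼
  small = ℚ.toℚᵘ-cancel-< (begin-strict
    toℚᵘ (ℤ.+ C / d)  ≃⟨ ℚ.toℚᵘ-fromℚᵘ (mkℚᵘ (ℤ.+ C) d-1) ⟩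
    mkℚᵘ (ℤ.+ C) d-1  <⟨ ℚᵘ.*<* (subst₂ ℤ._<_ (trans (cong ℤ.+_ (*-comm 4 C)) (ℤ.pos-* C 4))
                         (sym (ℤ.*-identityˡ (ℤ.+ d))) (ℤ.+<+ 4C<d)) ⟩
    toℚᵘ ¼          ∎)

-- With c = 2 - ε and ε ≥ δ, the error η = δ/4 already separates x ≤ 1 from 2 ≤ c x.
separation : ∀ δ e x → 0ℚ ℚ.< δ → δ ℚ.≤ e → e ℚ.≤ 2ℚ → x ℚ.≤ 1ℚ ℚ.+ δ ℚ.* ¼ →
  ¬ (2ℚ ℚ.≤ (2ℚ ℚ.- e) ℚ.* x ℚ.+ δ ℚ.* ¼)
separation δ e x 0<δ δ≤e e≤2 x≤1+η 2≤cx+η = ℚ.<-irrefl refl (begin-strict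
  2ℚ                                     ≤⟨ 2≤cx+η ⟩
  (2ℚ ℚ.- e) ℚ.* x ℚ.+ η                 ≤⟨ ℚ.+-monoˡ-≤ η
                                              (ℚ.*-monoˡ-≤-nonNeg (2ℚ ℚ.- e) x≤1+η) ⟩
  (2ℚ ℚ.- e) ℚ.* (1ℚ ℚ.+ η) ℚ.+ η        ≤⟨ ℚ.+-monoˡ-≤ η (ℚ.*-monoʳ-≤-nonNeg (1ℚ ℚ.+ η)
                                              (ℚ.+-monoʳ-≤ 2ℚ (ℚ.neg-antimono-≤ δ≤e))) ⟩
  (2ℚ ℚ.- δ) ℚ.* (1ℚ ℚ.+ η) ℚ.+ η        ≡⟨ expand δ ⟩
  2ℚ ℚ.- (η ℚ.+ δ ℚ.* η)                 <⟨ ℚ.+-monoʳ-< 2ℚ (ℚ.neg-antimono-< excess) ⟩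
  2ℚ ℚ.- 0ℚ                              ≡⟨⟩
  2ℚ                                     ∎)
  where
  open ℚ.≤-Reasoning
  η = δ ℚ.* ¼
  instance
    δ>0 : ℚ.Positive δ
    δ>0 = ℚ.positive 0<δ
    η>0 : ℚ.Positive η
    η>0 = ℚ.pos*pos⇒pos δ ¼
    1+η≥0 : ℚ.NonNegative (1ℚ ℚ.+ η)
    1+η≥0 = ℚ.pos⇒nonNeg (1ℚ ℚ.+ η) {{ℚ.pos+pos⇒pos 1ℚ η}}
    c≥0 : ℚ.NonNegative (2ℚ ℚ.- e)
    c≥0 = ℚ.nonNegative
      (subst (ℚ._≤ 2ℚ ℚ.- e) (ℚ.+-inverseʳ e) (ℚ.+-monoˡ-≤ (ℚ.- e) e≤2))
  excess : 0ℚ ℚ.< η ℚ.+ δ ℚ.* η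
  excess = ℚ.positive⁻¹ _ {{ℚ.pos+pos⇒pos η (δ ℚ.* η) {{ℚ.pos*pos⇒pos δ η}}}}
  expand : ∀ δ → (2ℚ ℚ.- δ) ℚ.* (1ℚ ℚ.+ δ ℚ.* ¼) ℚ.+ δ ℚ.* ¼ ≡
    2ℚ ℚ.- (δ ℚ.* ¼ ℚ.+ δ ℚ.* (δ ℚ.* ¼))
  expand = solve 1 (λ δ →
    (con 2ℚ :- δ) :* (con 1ℚ :+ δ :* con ¼) :+ δ :* con ¼ :=
    con 2ℚ :- (δ :* con ¼ :+ δ :* (δ :* con ¼))) refl
    where open ℚ-Solver

-- One index beyond all four thresholds reduces the claim to the rational `separation` of
-- approximants.
no-common-estimate : ∀ ε x → fromℕ 0 <ℝ ε → ε ≤ℝ fromℕ 1 →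
  x ≤ℝ fromℕ 1 → ¬ (fromℕ 2 ≤ℝ (fromℕ 2 -ℝ ε) *ℝ x)
no-common-estimate (real e _) (real x _) (δ , 0<δ , N₁ , δ≤e) e≤1 x≤1 2≤cx =
  -- Slack 1 in ε ≤ 1 gives `e k ≤ 2`, which keeps the factor 2 - `e k` nonnegative.
  let N₂ , h₂ = e≤1 1ℚ (ℚ.positive⁻¹ 1ℚ)
      N₃ , h₃ = x≤1 (δ ℚ.* ¼) 0<η
      N₄ , h₄ = 2≤cx (δ ℚ.* ¼) 0<η
      k = N₁ + N₂ + N₃ + N₄
  in separation δ (e k) (x k) 0<δ
       (subst (ℚ._≤ e k) (ℚ.+-identityˡ δ)
         (δ≤e k (≤-trans (m≤m+n N₁ N₂) (≤-trans (m≤m+n _ N₃) (m≤m+n _ N₄)))))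
       (h₂ k (≤-trans (m≤n+m N₂ N₁) (≤-trans (m≤m+n _ N₃) (m≤m+n _ N₄))))
       (h₃ k (≤-trans (m≤n+m N₃ (N₁ + N₂)) (m≤m+n _ N₄)))
       (h₄ k (m≤n+m N₄ _))
  where
  0<η : 0ℚ ℚ.< δ ℚ.* ¼
  0<η = ℚ.positive⁻¹ _ {{ℚ.pos*pos⇒pos δ {{ℚ.positive 0<δ}} ¼}}

≤ℝ-trans-fromℕ : ∀ {x a b} → x ≤ℝ fromℕ a → a ≤ b → x ≤ℝ fromℕ b
≤ℝ-trans-fromℕ x≤a a≤b ε 0<ε = let N , h = x≤a ε 0<ε in
  N , λ i N≤i → ℚ.≤-trans (h i N≤i) (ℚ.+-monoˡ-≤ ε (/1-mono-≤ a≤b))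

fromℕ-≤ℝ-trans : ∀ {x a b} → a ≤ b → fromℕ b ≤ℝ x → fromℕ a ≤ℝ x
fromℕ-≤ℝ-trans a≤b b≤x ε 0<ε = let N , h = b≤x ε 0<ε in
  N , λ i N≤i → ℚ.≤-trans (/1-mono-≤ a≤b) (h i N≤i)

module _ (ε : ℝ) (0<ε : fromℕ 0 <ℝ ε) (ε≤1 : ε ≤ℝ fromℕ 1) where

  approximations-differ : ∀ {n} {i j : Fin n} → i ≢ j → ∀ x →
    IsDiameterApprox (complete n) (fromℕ 2 -ℝ ε) x →
    ¬ IsDiameterApprox (almostComplete i j) (fromℕ 2 -ℝ ε) x
  approximations-differ i≢j x (D₁ , diam₁ , _ , x≤D₁) (D₂ , diam₂ , D₂≤cx , _) =
    no-common-estimate ε x 0<ε ε≤1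
      (≤ℝ-trans-fromℕ {x} x≤D₁ (complete-diameter diam₁))
      (fromℕ-≤ℝ-trans {(fromℕ 2 -ℝ ε) *ℝ x} (almostComplete-diameter _ _ i≢j diam₂) D₂≤cx)

-- Averaging over the coins

-- The value beyond the end of the word is arbitrary: a cylinder in a `Cover` guarantees its event
-- for every extension.
pad : ∀ {m} → Vec Bool m → ℕ → Bool
pad []       _       = false
pad (b ∷ bs) zero    = b
pad (b ∷ bs) (suc k) = pad bs k

pad-truncate : ∀ {m M} (m≤M : m ≤ M) (bs : Vec Bool M) (k : Fin m) →
  pad bs (toℕ k) ≡ lookup (truncate m≤M bs) k
pad-truncate (s≤s m≤M) (b ∷ bs) zero    = refl
pad-truncate (s≤s m≤M) (b ∷ bs) (suc k) = pad-truncate m≤M bs k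

shorten : ∀ {n m M} → m ≤ M → Vec (Vec Bool M) n → Vec (Vec Bool m) n
shorten m≤M = Vec.map (truncate m≤M)

coinsOf : ∀ {n M} → Vec (Vec Bool M) n → Coins n
coinsOf w v = pad (lookup w v)

coinsOf-extends : ∀ {n m M} (m≤M : m ≤ M) (w : Vec (Vec Bool M) n) →
  coinsOf w Extends shorten m≤M w
coinsOf-extends m≤M w v k = trans (pad-truncate m≤M (lookup w v) k)
  (cong (λ bs → lookup bs k) (sym (Vec.lookup-map v (truncate m≤M) w)))

infix 4 _≟ʷ_
_≟ʷ_ : ∀ {m n} → DecidableEquality (Vec (Vec Bool m) n)
_≟ʷ_ = Vec.≡-dec (Vec.≡-dec Bool._≟_)

module _ {m n : ℕ} where
  open DecMembership (_≟ʷ_ {m} {n}) public using (_∈?_)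

-- `ProbAtLeast` at level 3/4 with denominators cleared: `large` says that the cylinders have total
-- measure at least 3/4.
record Cover {n} (E : Coins n → Set) : Set where
  field
    depth     : ℕ
    cylinders : List (Vec (Vec Bool depth) n)
    unique    : Unique cylinders
    inside    : All (λ w → ∀ ω → ω Extends w → E ω) cylinders
    large     : 3 * 2 ^ (n * depth) ≤ 4 * length cylinders

  inside-coinsOf : ∀ {M} (d≤M : depth ≤ M) w → shorten d≤M w ∈ cylinders → E (coinsOf w)
  inside-coinsOf d≤M w w∈ = All.lookup inside w∈ (coinsOf w) (coinsOf-extends d≤M w)

  -- All prefixes have equally many extensions, so lengthening the words preserves the proportion of
  -- good ones. Covers of different depths thus become comparable at one length.
  three-quarters : ∀ {M} (d≤M : depth ≤ M) → 3 * size (words M n) ≤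
    4 * ∑ (words M n) (λ w → ⟦ does (shorten d≤M w ∈? cylinders) ⟧)
  three-quarters {M} d≤M = begin
    3 * size (words M n)                ≡⟨ cong (3 *_) (uniform (λ _ → 1)) ⟩
    3 * (r * size (words depth n))      ≡⟨ swap 3 r _ ⟩
    r * (3 * size (words depth n))      ≡⟨ cong (λ s → r * (3 * s)) (words-size depth n) ⟩
    r * (3 * 2 ^ (n * depth))           ≤⟨ *-monoʳ-≤ r large ⟩
    r * (4 * length cylinders)          ≤⟨ *-monoʳ-≤ r (*-monoʳ-≤ 4
                                             (unique-length≤∑ _≟ʷ_ (words depth n) cylinders unique)) ⟩
    r * (4 * ∑ (words depth n) member)  ≡⟨ swap r 4 _ ⟩
    4 * (r * ∑ (words depth n) member)  ≡⟨ cong (4 *_) (sym (uniform member)) ⟩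
    4 * ∑ (words M n) (member ∘ shorten d≤M) ∎
    where
    open ≤-Reasoning
    open ℕ-Solver using (solve; con; _:=_; _:+_; _:*_)
    r = (2 ^ (M ∸ depth)) ^ n
    member = λ w → ⟦ does (w ∈? cylinders) ⟧
    uniform = vecMap-uniform (vecSummation boolSummation M) (vecSummation boolSummation depth)
      (truncate-uniform d≤M) n
    swap : ∀ a b c → a * (b * c) ≡ b * (a * c)
    swap = solve 3 (λ a b c → a :* (b :* c) := b :* (a :* c)) refl

open Cover

probable-cover : ∀ {n} {E : Coins n → Set} {p} → ¾ ℚ.< p → ProbAtLeast E p → Cover E
probable-cover {n} ¾<p prob with m , S , unique , inside , large ← prob ¾ ¾<p = record
  { depth = m ; cylinders = S ; unique = unique ; inside = inside
  ; large = ¾-cancel (2 ^ (n * m)) (length S) large }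

cover-map : ∀ {n} {E F : Coins n → Set} → (∀ {ω} → E ω → F ω) → Cover E → Cover F
cover-map E⊆F c = record
  { depth = depth c ; cylinders = cylinders c ; unique = unique c
  ; inside = All.map (λ E ω ext → E⊆F (E ω ext)) (inside c) ; large = large c }

-- Exposed pairs and double counting

module _ (ε : ℝ) (0<ε : fromℕ 0 <ℝ ε) (ε≤1 : ε ≤ℝ fromℕ 1)
         (μ : Model) (P : Protocol) {n : ℕ} where

  private
    c  = fromℕ 2 -ℝ ε
    Kₙ = complete n

  -- Otherwise both runs agree up to `T`, so `i` outputs one value for both graphs, against
  -- `approximations-differ`. The success times may differ, so outputs are compared at `T ⊔ t`.
  exposed : ∀ {i j} → i ≢ j → ∀ ω → ((T , _) : Succeeds μ c P Kₙ ω) →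
    Succeeds μ c P (almostComplete i j) ω →
    1 ≤ exposure P μ Kₙ ω T i j + exposure P μ Kₙ ω T j i
  exposed {i} {j} i≢j ω (T , success) (t , success′) = n≢0⇒n>0 λ none →
    let x , out  , approx  = success i
        y , out′ , approx′ = success′ i
        same = run-deleteEdge P μ Kₙ ω i j T (m+n≡0⇒m≡0 _ none)
                 (m+n≡0⇒n≡0 (exposure P μ Kₙ ω T i j) none) i
        x≡y = just-injective (trans
          (sym (output-stable P μ (almostComplete i j) ω (m≤m⊔n T t)
            (trans (cong output same) out)))
          (output-stable P μ (almostComplete i j) ω (m≤n⊔m T t) out′))
    in approximations-differ ε 0<ε ε≤1 i≢j x approx
         (subst (IsDiameterApprox (almostComplete i j) c) (sym x≡y) approx′)

  module _ (cover₀ : Cover (Succeeds μ c P Kₙ))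
           (cover : (i j : Fin n) → Cover {n} (λ ω → i ≢ j → Succeeds μ c P (almostComplete i j) ω))
           {E : ℕ} (cheap : (ω : Coins n) (t : ℕ) (v : Fin n) → energy (run P μ Kₙ ω t v) ≤ E) where

    private
      M : ℕ
      M = depth cover₀ + sum (λ i → sum (λ j → depth (cover i j)))

      d₀≤M : depth cover₀ ≤ M
      d₀≤M = m≤m+n _ _

      d≤M : ∀ i j → depth (cover i j) ≤ M
      d≤M i j = begin
        depth (cover i j)
          ≤⟨ term≤∑ (finSummation n) (λ j → depth (cover i j)) j ⟩
        sum (λ j → depth (cover i j))
          ≤⟨ term≤∑ (finSummation n) (λ i → sum (λ j → depth (cover i j))) i ⟩
        sum (λ i → sum (λ j → depth (cover i j)))
          ≤⟨ m≤n+m _ (depth cover₀) ⟩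
        M ∎
        where open ≤-Reasoning

      Word = Vec (Vec Bool M) n
      Σʷ = words M n

      -- The decision is an argument so that `both-succeed` can case on it. Outside the cover the
      -- default time 0 makes every exposure 0.
      success-time : ∀ w → Dec (shorten d₀≤M w ∈ cylinders cover₀) → ℕ
      success-time w (yes w∈) = proj₁ (inside-coinsOf cover₀ d₀≤M w w∈)
      success-time w (no _)   = 0

      horizon : Word → ℕ
      horizon w = success-time w (shorten d₀≤M w ∈? cylinders cover₀)

      hit : Word → Fin n → Fin n → ℕ
      hit w i j = exposure P μ Kₙ (coinsOf w) (horizon w) i j

      -- The diagonal term makes the bound hold for all n² pairs.
      weight : Fin n → Fin n → Word → ℕ
      weight i j w = ⟦ does (j Fin.≟ i) ⟧ + (hit w i j + hit w j i)

      -- The indicators sum to more than 1 only when both runs succeed; off the diagonal `exposed`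
      -- then makes the weight positive.
      both-succeed : ∀ i j w →
        ⟦ does (shorten d₀≤M w ∈? cylinders cover₀) ⟧ +
        ⟦ does (shorten (d≤M i j) w ∈? cylinders (cover i j)) ⟧ ≤ 1 + weight i j w
      both-succeed i j w = byCase (shorten d₀≤M w ∈? cylinders cover₀)
        (shorten (d≤M i j) w ∈? cylinders (cover i j)) (j Fin.≟ i)
        where
        byCase : ∀ d₀ (d : Dec (shorten (d≤M i j) w ∈ cylinders (cover i j)))
          (eq? : Dec (j ≡ i)) → ⟦ does d₀ ⟧ + ⟦ does d ⟧ ≤ 1 + (⟦ does eq? ⟧ +
            (exposure P μ Kₙ (coinsOf w) (success-time w d₀) i j +
             exposure P μ Kₙ (coinsOf w) (success-time w d₀) j i))
        byCase (no _)    (no _)   _        = z≤n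
        byCase (no _)    (yes _)  _        = s≤s z≤n
        byCase (yes _)   (no _)   _        = s≤s z≤n
        byCase (yes _)   (yes _)  (yes _)  = s≤s (s≤s z≤n)
        byCase (yes w∈₀) (yes w∈) (no j≢i) = s≤s
          (exposed (j≢i ∘ sym) (coinsOf w) (inside-coinsOf cover₀ d₀≤M w w∈₀)
            (inside-coinsOf (cover i j) (d≤M i j) w w∈ (j≢i ∘ sym)))

      -- With N words and total weight W of the pair, the two 3/4 bounds give 6N ≤ 4(N + W), hence N
      -- ≤ 2W: the mean weight is at least 1/2.
      half : ∀ i j → size Σʷ ≤ 2 * ∑ Σʷ (weight i j)
      half i j = *-cancelˡ-≤ 2 (+-cancelˡ-≤ (4 * N) _ _ (begin
        4 * N + 2 * N                    ≡⟨ solve 1 (λ N → con 4 :* N :+ con 2 :* N :=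
                                              con 3 :* N :+ con 3 :* N) refl N ⟩
        3 * N + 3 * N                    ≤⟨ +-mono-≤ (three-quarters cover₀ d₀≤M)
                                              (three-quarters (cover i j) (d≤M i j)) ⟩
        4 * ∑ Σʷ χ₀ + 4 * ∑ Σʷ χ         ≡⟨ sym (*-distribˡ-+ 4 (∑ Σʷ χ₀) (∑ Σʷ χ)) ⟩
        4 * (∑ Σʷ χ₀ + ∑ Σʷ χ)           ≡⟨ cong (4 *_) (sym (∑-+ Σʷ χ₀ χ)) ⟩
        4 * ∑ Σʷ (λ w → χ₀ w + χ w)      ≤⟨ *-monoʳ-≤ 4 (∑-mono Σʷ (both-succeed i j)) ⟩
        4 * ∑ Σʷ (λ w → 1 + weight i j w) ≡⟨ cong (4 *_) (∑-+ Σʷ (λ _ → 1) (weight i j)) ⟩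
        4 * (N + ∑ Σʷ (weight i j))      ≡⟨ solve 2 (λ N I → con 4 :* (N :+ I) :=
                                              con 4 :* N :+ con 2 :* (con 2 :* I)) refl N _ ⟩
        4 * N + 2 * (2 * ∑ Σʷ (weight i j)) ∎))
        where
        open ≤-Reasoning
        open ℕ-Solver using (solve; con; _:=_; _:+_; _:*_)
        N = size Σʷ
        χ₀ χ : Word → ℕ
        χ₀ w = ⟦ does (shorten d₀≤M w ∈? cylinders cover₀) ⟧
        χ w  = ⟦ does (shorten (d≤M i j) w ∈? cylinders (cover i j)) ⟧

      sum-const : ∀ a → sum {n} (λ _ → a) ≡ a * n
      sum-const a = trans (∑-const (finSummation n) a) (cong (a *_) (sum-size n))

      total-hit : ∀ w → sum (λ i → sum (hit w i)) ≤ 2 * E * n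
      total-hit w = begin
        sum (λ i → sum (hit w i))
          ≤⟨ ∑-mono (finSummation n) (λ i → ≤-trans
               (sum-exposure P μ Kₙ (coinsOf w) (horizon w) i)
               (*-monoʳ-≤ 2 (cheap (coinsOf w) (horizon w) i))) ⟩
        sum {n} (λ _ → 2 * E)  ≡⟨ sum-const (2 * E) ⟩
        2 * E * n              ∎
        where open ≤-Reasoning

      -- The diagonal contributes `n`, and each of the two orientations of the pairs at most
      -- `2 * E * n`.
      total-weight : ∀ w → sum (λ i → sum (λ j → weight i j w)) ≤ n * (1 + 4 * E)
      total-weight w = begin
        sum (λ i → sum (λ j → weight i j w))
          ≡⟨ ∑-cong Σᶠ (λ i → trans (∑-+ Σᶠ (λ j → ⟦ does (j Fin.≟ i) ⟧) _)
               (cong₂ _+_ (sum-point i) (∑-+ Σᶠ (hit w i) (λ j → hit w j i)))) ⟩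
        sum (λ i → 1 + (sum (hit w i) + sum (λ j → hit w j i)))
          ≡⟨ ∑-+ Σᶠ (λ _ → 1) _ ⟩
        sum {n} (λ _ → 1) + sum (λ i → sum (hit w i) + sum (λ j → hit w j i))
          ≡⟨ cong₂ _+_ (sum-size n) (∑-+ Σᶠ (λ i → sum (hit w i)) _) ⟩
        n + (sum (λ i → sum (hit w i)) + sum (λ i → sum (λ j → hit w j i)))
          ≡⟨ cong (λ s → n + (sum (λ i → sum (hit w i)) + s))
               (∑-sum-swap Σᶠ (λ j i → hit w j i)) ⟩
        n + (sum (λ i → sum (hit w i)) + sum (λ i → sum (hit w i)))
          ≤⟨ +-monoʳ-≤ n (+-mono-≤ (total-hit w) (total-hit w)) ⟩
        n + (2 * E * n + 2 * E * n)
          ≡⟨ solve 2 (λ n E → n :+ (con 2 :* E :* n :+ con 2 :* E :* n) :=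
               n :* (con 1 :+ con 4 :* E)) refl n E ⟩
        n * (1 + 4 * E) ∎
        where
        open ≤-Reasoning
        open ℕ-Solver using (solve; con; _:=_; _:+_; _:*_)
        Σᶠ = finSummation n

    -- Count the weight over words and ordered pairs in two ways: at least N/2 for each of the n²
    -- pairs, at most n(1 + 4E) for each of the N words. Cancelling nN leaves the bound.
    energy-lower-bound : .{{NonZero n}} → n ≤ 2 + 8 * E
    energy-lower-bound = *-cancelʳ-≤ n (2 + 8 * E) (n * N) (begin
      n * (n * N)                          ≡⟨ solve 2 (λ n N → n :* (n :* N) := N :* n :* n) refl n N ⟩
      N * n * n                            ≡⟨ sym (sum-const (N * n)) ⟩
      sum {n} (λ _ → N * n)                ≡⟨ sym (∑-cong Σᶠ (λ _ → sum-const N)) ⟩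
      sum {n} (λ _ → sum {n} (λ _ → N))    ≤⟨ ∑-mono Σᶠ (λ i → ∑-mono Σᶠ (half i)) ⟩
      sum (λ i → sum (λ j → 2 * ∑ Σʷ (weight i j)))
        ≡⟨ trans (∑-cong Σᶠ (λ i → ∑-* Σᶠ 2 (λ j → ∑ Σʷ (weight i j)))) (∑-* Σᶠ 2 _) ⟩
      2 * sum (λ i → sum (λ j → ∑ Σʷ (weight i j)))
        ≡⟨ cong (2 *_) (sym (trans (∑-sum-swap Σʷ (λ i w → sum (λ j → weight i j w)))
             (∑-cong Σᶠ (λ i → ∑-sum-swap Σʷ (weight i))))) ⟩
      2 * ∑ Σʷ (λ w → sum (λ i → sum (λ j → weight i j w)))
        ≤⟨ *-monoʳ-≤ 2 (∑-mono Σʷ total-weight) ⟩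
      2 * ∑ Σʷ (λ _ → n * (1 + 4 * E))     ≡⟨ cong (2 *_) (∑-const Σʷ _) ⟩
      2 * (n * (1 + 4 * E) * N)
        ≡⟨ solve 3 (λ n N E → con 2 :* (n :* (con 1 :+ con 4 :* E) :* N) :=
             (con 2 :+ con 8 :* E) :* (n :* N)) refl n N E ⟩
      (2 + 8 * E) * (n * N) ∎)
      where
      open ≤-Reasoning
      open ℕ-Solver using (solve; con; _:=_; _:+_; _:*_)
      Σᶠ = finSummation n
      N = size Σʷ
      instance
        N≢0 : NonZero N
        N≢0 = subst NonZero (sym (words-size M n)) (m^n≢0 2 (n * M))
        nN≢0 : NonZero (n * N)
        nN≢0 = m*n≢0 n N

theorem5p1 : (μ : Model) (ε : ℝ) → fromℕ 0 <ℝ ε → ε ≤ℝ fromℕ 1 →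
    ∃[ K ] ((A : Algorithm) → ApproximatesDiameterWHP μ (fromℕ 2 -ℝ ε) A →
    ∃[ n₀ ] (∀ n → n₀ ≤ n → ∀ E → EnergyCostAtMost μ A n E → n ≤ K * E))
-- For n ≥ 4 the additive constant is absorbed: 2n ≤ 4 + 16E ≤ n + 16E. The summand 4C makes n
-- exceed 4C, so the failure probability C/nᵏ is below 1/4.
theorem5p1 μ ε 0<ε ε≤1 = 16 , λ A (C , k , 1≤k , whp) → 4 + 4 * C , λ n n₀≤n E cost →
  bound A C k 1≤k whp n n₀≤n E cost
  where
  bound : ∀ A C k → 1 ≤ k →
    (∀ n .{{_ : NonZero n}} (G : Graph n) → Connected G → IsUnitDisc G →
      ProbAtLeast (Succeeds μ (fromℕ 2 -ℝ ε) (A n) G)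
        (1ℚ ℚ.- (ℚ._/_ (ℤ.+ C) (n ^ k) {{m^n≢0 n k}}))) →
    ∀ n → 4 + 4 * C ≤ n → ∀ E → EnergyCostAtMost μ A n E → n ≤ 16 * E
  -- The pattern exposes the three vertices that `almostComplete-connected` asks for; smaller n
  -- contradict the threshold.
  bound A C k 1≤k whp n@(suc (suc (suc _))) n₀≤n E cost = +-cancelˡ-≤ n _ _ (begin
    n + n                ≤⟨ +-mono-≤ lower lower ⟩
    (2 + 8 * E) + (2 + 8 * E)
      ≡⟨ solve 1 (λ E → (con 2 :+ con 8 :* E) :+ (con 2 :+ con 8 :* E) :=
           con 4 :+ con 16 :* E) refl E ⟩
    4 + 16 * E           ≤⟨ +-monoˡ-≤ (16 * E) (m+n≤o⇒m≤o 4 n₀≤n) ⟩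
    n + 16 * E           ∎)
    where
    open ≤-Reasoning
    open ℕ-Solver using (solve; con; _:=_; _:+_; _:*_)
    4C<nᵏ : 4 * C < n ^ k
    4C<nᵏ = begin-strict
      4 * C     <⟨ m<n+m (4 * C) {4} (s≤s z≤n) ⟩
      4 + 4 * C ≤⟨ n₀≤n ⟩
      n         ≡⟨ sym (^-identityʳ n) ⟩
      n ^ 1     ≤⟨ ^-monoʳ-≤ n 1≤k ⟩
      n ^ k     ∎

    likely : ∀ G → Connected G → IsUnitDisc G → Cover (Succeeds μ (fromℕ 2 -ℝ ε) (A n) G)
    likely G connected unitDisc =
      probable-cover (¾<1- C (n ^ k) {{m^n≢0 n k}} 4C<nᵏ) (whp n G connected unitDisc)

    complete-cover = likely (complete n) (complete-connected n) (complete-isUnitDisc n)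

    almostComplete-cover : ∀ i j → Dec (i ≡ j) →
      Cover (λ ω → i ≢ j → Succeeds μ (fromℕ 2 -ℝ ε) (A n) (almostComplete i j) ω)
    -- For i = j the event holds vacuously, so the cylinders of the other cover can be borrowed.
    almostComplete-cover i j (yes i≡j) =
      cover-map (λ _ i≢j → contradiction i≡j i≢j) complete-cover
    almostComplete-cover i j (no i≢j) = cover-map (λ success _ → success)
      (likely (almostComplete i j) (almostComplete-connected i j) (almostComplete-isUnitDisc i≢j))

    lower : n ≤ 2 + 8 * E
    lower = energy-lower-bound ε 0<ε ε≤1 μ (A n) complete-cover
      (λ i j → almostComplete-cover i j (i Fin.≟ j))
      (cost (complete n) (complete-connected n) (complete-isUnitDisc n))
  bound A C k 1≤k whp 1 (s≤s ()) E cost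
  bound A C k 1≤k whp 2 (s≤s (s≤s ())) E cost
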